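{- Let $m\le n$ and $r,k$ be positive integers and let $V$ be a set of $m$ vertices. Let $\mathcal F=K_m^3\cup (n-m)K_m^2 \cup \binom{n-m}{2} K_m^1$ on vertex set $V$, and let a $k$-hyperedge-coloring of $\mathcal F$ be given. For each color $j$ let $\mathcal F(j)$ be the sub-hypergraph of hyperedges of color $j$, $d_{\mathcal F(j)}(v)$ the number of hyperedges of color $j$ containing $v$, and $E^i(\mathcal F(j))$ the set of hyperedges of $\mathcal F$ of size $i$ and color $j$. Then this coloring of $\mathcal F$ can be extended to an $r$-factorization of $\mathcal G=K_n^3$ if and only if all of the following hold: (i) $3 \mid rn$; (ii) $r \mid \binom{n-1}{2}$; (iii) $k=\binom{n-1}{2}/r$; (iv) $d_{\mathcal F(j)}(v)= r$ for each $v\in V$ and each $1\leq j\leq k$; (v) $|E^2(\mathcal F(j))|+2|E^3(\mathcal F(j))|\geq r(m-n/3)$ for each $1\leq j\leq k$.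
   Context: $K_m^3$ is the complete $3$-uniform hypergraph on $V$ (each $3$-subset of $V$ is a hyperedge once), $K_m^2$ is the complete graph on $V$ (each $2$-subset a hyperedge once), and $K_m^1$ is the hypergraph on $V$ whose hyperedges are the $m$ singletons $\{v\}$, $v\in V$. For a hypergraph $\mathcal H$ and integer $\lambda\ge 1$, $\lambda\mathcal H$ denotes the multi-hypergraph in which each hyperedge of $\mathcal H$ is replaced by $\lambda$ copies; $\mathcal H_1\cup\mathcal H_2\cup\mathcal H_3$ for hypergraphs on the same vertex set $V$ is the hypergraph on $V$ whose hyperedge (multi)set is the union of their hyperedge (multi)sets. Thus $\mathcal F$ has each $3$-subset of $V$ once, each $2$-subset $n-m$ times, and each singleton $\binom{n-m}{2}$ times. A $k$-hyperedge-coloring is a map from the hyperedges (copies counted separately) to $k$ colors. $K_n^3$ is the complete $3$-uniform hypergraph on $n$ vertices. An $r$-factor is a spanning sub-hypergraph in which every vertex lies in exactly $r$ hyperedges; an $r$-factorization is a partition of the hyperedges into $r$-factors. The coloring of $\mathcal F$ is extended to an $r$-factorization of $K_n^3$ if, taking $K_n^3$ on vertex set $V\cup U$ with $U\cap V=\emptyset$ and $|U|=n-m$, there is a hyperedge-coloring of $K_n^3$ in which every color class is an $r$-factor and, for every subset $S\subseteq V$ with $1\le |S|\le 3$, the multiset of colors of the hyperedges $e$ of $K_n^3$ with $e\cap V=S$ equals the multiset of colors of the copies of $S$ in $\mathcal F$ (i.e. each hyperedge of $\mathcal F$ of size $1$ or $2$ is completed to a distinct hyperedge of $K_n^3$ by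 adding vertices of $U$, keeping its color). -}

module Defs where

open import Data.Nat using (ℕ; zero; suc; _+_; _*_; _∸_; _≤_; _<ᵇ_)
open import Data.Bool using (Bool; true; false; _∨_; _∧_; if_then_else_)
open import Data.Fin using (Fin; toℕ; _↑ˡ_; _<_)
open import Data.Fin.Properties using (_<?_)
open import Data.List using (List; []; _∷_; [_]; map; concatMap; allFin; length; filterᵇ)
open import Data.Nat.ListAction using (sum)
open import Data.Product using (_×_)
open import Relation.Binary.PropositionalEquality using (_≡_)
open import Data.List.Properties using (≡-dec)
open import Data.Nat.Combinatorics using (_C_)
open import Relation.Nullary using (yes; no)
open import Relation.Nullary.Decidable using (⌊_⌋)
import Data.Fin as F

count : {A : Set} → (A → Bool) → List A → ℕ
count p xs = length (filterᵇ p xs)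

_==_ : {n : ℕ} → Fin n → Fin n → Bool
i == j = ⌊ i F.≟ j ⌋

-- 3-subsets and 2-subsets of Fin n, represented by their increasing
-- listing of elements

record Triple (n : ℕ) : Set where
  constructor triple
  field
    a b c : Fin n
    a<b : a < b
    b<c : b < c

record Pair (n : ℕ) : Set where
  constructor pair
  field
    a b : Fin n
    a<b : a < b

allTriples : (n : ℕ) → List (Triple n)
allTriples n =
  concatMap (λ x → concatMap (λ y → concatMap (λ z → mk x y z) (allFin n)) (allFin n)) (allFin n)
  where
  mk : (x y z : Fin n) → List (Triple n)
  mk x y z with x <? y | y <? z
  ... | yes p | yes q = [ triple x y z p q ]
  ... | _ | _ = []

allPairs : (n : ℕ) → List (Pair n)
allPairs n = concatMap (λ x → concatMap (λ y → mk x y) (allFin n)) (allFin n)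
  where
  mk : (x y : Fin n) → List (Pair n)
  mk x y with x <? y
  ... | yes p = [ pair x y p ]
  ... | no _ = []

elems3 : {n : ℕ} → Triple n → List (Fin n)
elems3 (triple x y z _ _) = x ∷ y ∷ z ∷ []

elems2 : {n : ℕ} → Pair n → List (Fin n)
elems2 (pair x y _) = x ∷ y ∷ []

_∈3_ : {n : ℕ} → Fin n → Triple n → Bool
v ∈3 (triple x y z _ _) = (v == x) ∨ (v == y) ∨ (v == z)

_∈2_ : {n : ℕ} → Fin n → Pair n → Bool
v ∈2 (pair x y _) = (v == x) ∨ (v == y)

-- The hypergraph  F = K_m^3 ∪ (u) K_m^2 ∪ C(u,2) K_m^1  on V = Fin m,
-- where u = n - m.  A k-hyperedge-coloring of F colors each 3-subset,
-- each of the u copies of each 2-subset and each of the C(u,2) copies of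
-- each singleton.

record FColoring (m u k : ℕ) : Set where
  field
    col3 : Triple m → Fin k
    col2 : Pair m → Fin u → Fin k
    col1 : Fin m → Fin (u C 2) → Fin k

open FColoring public

module _ {m u k : ℕ} (φ : FColoring m u k) where

  E3 : Fin k → ℕ
  E3 j = count (λ S → col3 φ S == j) (allTriples m)

  E2 : Fin k → ℕ
  E2 j = count (λ St → col2 φ (Data.Product.proj₁ St) (Data.Product.proj₂ St) == j)
               (Data.List.cartesianProduct (allPairs m) (allFin u))
    where import Data.Product

  degF : Fin m → Fin k → ℕ
  degF v j =
      count (λ S → (v ∈3 S) ∧ (col3 φ S == j)) (allTriples m)
    + sum (map (λ S → if v ∈2 S then count (λ t → col2 φ S t == j) (allFin u) else 0) (allPairs m))
    + count (λ s → col1 φ v s == j) (allFin (u C 2))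

-- K_N^3 on vertex set Fin (m + u) = V ⊎ U, where V = Fin m is embedded
-- by inject+ (the first m vertices) and U is the last u vertices.

KColoring : (N k : ℕ) → Set
KColoring N k = Triple N → Fin k

IsRFactorization : {N k : ℕ} → ℕ → KColoring N k → Set
IsRFactorization {N} {k} r ψ =
  (w : Fin N) (j : Fin k) → count (λ e → (w ∈3 e) ∧ (ψ e == j)) (allTriples N) ≡ r

traceV : {u : ℕ} (m : ℕ) → Triple (m + u) → List (Fin (m + u))
traceV m e = filterᵇ (λ v → toℕ v <ᵇ m) (elems3 e)

ι : {m : ℕ} (u : ℕ) → Fin m → Fin (m + u)
ι u i = i ↑ˡ u

_=L_ : {N : ℕ} → List (Fin N) → List (Fin N) → Bool
xs =L ys = ⌊ ≡-dec F._≟_ xs ys ⌋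

-- colors of the hyperedges e of K_n^3 with e ∩ V = S, as a multiset over
-- Fin k, equal the colors of the copies of S in F.
Extends : {m u k : ℕ} → FColoring m u k → KColoring (m + u) k → Set
Extends {m} {u} {k} φ ψ =
    ((S : Triple m) (j : Fin k) →
       count (λ e → (traceV m e =L map (ι u) (elems3 S)) ∧ (ψ e == j)) (allTriples (m + u))
       ≡ count (λ _ → col3 φ S == j) [ S ])
  × ((S : Pair m) (j : Fin k) →
       count (λ e → (traceV m e =L map (ι u) (elems2 S)) ∧ (ψ e == j)) (allTriples (m + u))
       ≡ count (λ t → col2 φ S t == j) (allFin u))
  × ((v : Fin m) (j : Fin k) →
       count (λ e → (traceV m e =L [ ι u v ]) ∧ (ψ e == j)) (allTriples (m + u))
       ≡ count (λ s → col1 φ v s == j) (allFin (u C 2)))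

{-# OPTIONS --safe #-}
-- Necessity is counting: color j must have E0 = rn/3 − E1 − E2 − E3 hyperedges inside U, and by (iv) the
-- inequality (v) says exactly that this number is not negative.
-- For sufficiency, color the hyperedges that meet V as F prescribes and those inside U arbitrarily with
-- E0 of each color. Then make the vertices w of U regular one at a time. Amalgamate the vertices from w
-- on; the hyperedges with the same amalgamated image form a class, and permuting colors inside classes
-- preserves all earlier degrees and all traces on V. If u vertices are amalgamated, a hyperedge with i of
-- them should go to w with weight i/u: this fractional selection has the right total in every class and
-- weight r in every color. An integral selection exists by a max-flow min-cut argument.
module Submission where

open import Defs
open import Data.Bool using (Bool; true; false; _∧_; _∨_; not; if_then_else_)
import Data.Bool.Properties as Bool
open import Data.Nat using (ℕ; zero; suc; _*_; _+_; _∸_; _≤_; _<_; _<ᵇ_; _<?_; _/_; NonZero; z≤n; s≤s; s≤s⁻¹)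
open import Data.Nat.Properties hiding (_<?_)
open import Data.Nat.Combinatorics using (_C_; nCk+nC[k+1]≡[n+1]C[k+1]; nC1≡n)
open import Data.Nat.Divisibility using (_∣_; divides)
open import Data.Nat.DivMod using (m*n/n≡m; m/n*n≡m)
open import Data.Nat.ListAction using (sum)
open import Data.Nat.ListAction.Properties using (sum-++; sum-↭)
open import Data.Nat.Tactic.RingSolver using (solve-∀)
open import Data.Fin using (Fin; zero; suc; toℕ; fromℕ<; _↑ˡ_; _↑ʳ_; combine) renaming (_<_ to _<ᶠ_)
import Data.Fin as Fin
open import Data.Fin.Properties using (toℕ-↑ˡ; toℕ-↑ʳ; toℕ<n; toℕ-injective; toℕ-fromℕ<; combine-injective; ↑ˡ-injective; ↑ʳ-injective) renaming (_<?_ to _<?ᶠ_)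
open import Data.Fin.Subset.Properties using (anySubset?)
open import Data.List using (List; []; _∷_; [_]; _++_; map; concatMap; allFin; length; filterᵇ; replicate; zip; cartesianProduct)
open import Data.List.Properties using (map-∘; map-++; map-tabulate; length-tabulate; ∷-injective) renaming (≡-dec to List-≡-dec)
open import Data.List.Membership.Propositional using (_∈_)
open import Data.List.Membership.Propositional.Properties using (∈-∃++)
open import Data.List.Relation.Unary.Any using (here; there)
open import Data.List.Relation.Binary.Permutation.Propositional using (_↭_; prep; refl; ↭-sym; ↭-trans; ↭-reflexive)
open import Data.List.Relation.Binary.Permutation.Propositional.Properties using (map⁺; shift; ↭-map-inv)
import Data.Vec as Vec
open import Data.Vec.Properties using (lookup∘tabulate)
open import Data.Product using (_×_; _,_; proj₁; proj₂; Σ-syntax)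
open import Data.Product.Properties using () renaming (≡-dec to ×-≡-dec)
open import Data.Sum using (_⊎_; inj₁; inj₂)
open import Data.Empty using (⊥-elim)
open import Function using (_∘_; id)
open import Function.Bundles using (_⇔_; mk⇔)
open import Relation.Nullary using (Dec; yes; no; ¬_)
open import Relation.Nullary.Decidable using (⌊_⌋)
open import Relation.Binary.Definitions using (DecidableEquality)
open import Relation.Binary.PropositionalEquality hiding ([_])

-- Making `w` regular is a transportation problem: each class must send as many of its colors to `w`
-- as it has triples through `w`, and each color must arrive `r` times. The fractional weights
-- respect both sides for different reasons. On the class side, any two amalgamated vertices lie in
-- equally many triples of a class. On the color side, a color has `rn` incidences in all, of which
-- every finished vertex takes `r`, so the amalgamated ones share the rest. A weight never exceeds
-- 1, because the `i` vertices it counts are distinct amalgamated vertices. The amalgamated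
-- multi-hypergraph is never built. A class is a set of genuine triples with a common `key`, and
-- only the colors move, so there is nothing to detach at the end. Statistics that see a triple only
-- through its class are preserved; this is expressed throughout by sums of arbitrary test functions
-- that respect the classes. At the start, the numbers E0 add up to the number of triples inside U
-- because (i), (ii) and (iii) give `k` color classes of size `rn/3`, which together have as many
-- hyperedges as `K_n^3`.

private variable
  A B P Q : Set
  m n u k : ℕ

-- Finite sums

⟦_⟧ : Bool → ℕ
⟦ true ⟧ = 1
⟦ false ⟧ = 0

⟦∧⟧ : ∀ b c → ⟦ b ∧ c ⟧ ≡ ⟦ b ⟧ * ⟦ c ⟧
⟦∧⟧ true c = sym (+-identityʳ _)
⟦∧⟧ false c = refl

isYes-true : {P : Set} (d : Dec P) → P → ⌊ d ⌋ ≡ true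
isYes-true (yes _) _ = refl
isYes-true (no ¬p) p = ⊥-elim (¬p p)

isYes-false : {P : Set} (d : Dec P) → ¬ P → ⌊ d ⌋ ≡ false
isYes-false (yes p) ¬p = ⊥-elim (¬p p)
isYes-false (no _) _ = refl

isYes⇒ : {P : Set} (d : Dec P) → ⌊ d ⌋ ≡ true → P
isYes⇒ (yes p) _ = p

isYes-cong : {P Q : Set} (d : Dec P) (d′ : Dec Q) → (P → Q) → (Q → P) → ⌊ d ⌋ ≡ ⌊ d′ ⌋
isYes-cong (yes p) d′ f g = sym (isYes-true d′ (f p))
isYes-cong (no ¬p) d′ f g = sym (isYes-false d′ (¬p ∘ g))

∑ : List A → (A → ℕ) → ℕ
∑ xs f = sum (map f xs)

count≡∑ : (p : A → Bool) (xs : List A) → count p xs ≡ ∑ xs (λ x → ⟦ p x ⟧)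
count≡∑ p [] = refl
count≡∑ p (x ∷ xs) with p x
... | true = cong suc (count≡∑ p xs)
... | false = count≡∑ p xs

∑-cong : (xs : List A) {f g : A → ℕ} → (∀ x → f x ≡ g x) → ∑ xs f ≡ ∑ xs g
∑-cong [] eq = refl
∑-cong (x ∷ xs) eq = cong₂ _+_ (eq x) (∑-cong xs eq)

∑-mono : (xs : List A) {f g : A → ℕ} → (∀ x → f x ≤ g x) → ∑ xs f ≤ ∑ xs g
∑-mono [] le = z≤n
∑-mono (x ∷ xs) le = +-mono-≤ (le x) (∑-mono xs le)

∑-0 : (xs : List A) → ∑ xs (λ _ → 0) ≡ 0
∑-0 [] = refl
∑-0 (x ∷ xs) = ∑-0 xs

∑-≡0 : (xs : List A) {f : A → ℕ} → (∀ x → f x ≡ 0) → ∑ xs f ≡ 0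
∑-≡0 xs eq = trans (∑-cong xs eq) (∑-0 xs)

∑-const : (xs : List A) (c : ℕ) → ∑ xs (λ _ → c) ≡ length xs * c
∑-const [] c = refl
∑-const (x ∷ xs) c = cong (c +_) (∑-const xs c)

∑-+ : (xs : List A) (f g : A → ℕ) → ∑ xs (λ x → f x + g x) ≡ ∑ xs f + ∑ xs g
∑-+ [] f g = refl
∑-+ (x ∷ xs) f g rewrite ∑-+ xs f g = lemma (f x) (g x) (∑ xs f) (∑ xs g)
  where
  lemma : ∀ a b c d → (a + b) + (c + d) ≡ (a + c) + (b + d)
  lemma = solve-∀

∑-*ˡ : (xs : List A) (c : ℕ) (f : A → ℕ) → ∑ xs (λ x → c * f x) ≡ c * ∑ xs f
∑-*ˡ [] c f = sym (*-zeroʳ c)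
∑-*ˡ (x ∷ xs) c f rewrite ∑-*ˡ xs c f = sym (*-distribˡ-+ c (f x) _)

∑-*ʳ : (xs : List A) (c : ℕ) (f : A → ℕ) → ∑ xs (λ x → f x * c) ≡ ∑ xs f * c
∑-*ʳ xs c f = trans (∑-cong xs (λ x → *-comm (f x) c)) (trans (∑-*ˡ xs c f) (*-comm c _))

∑-swap : (xs : List A) (ys : List B) (f : A → B → ℕ) →
         ∑ xs (λ x → ∑ ys (f x)) ≡ ∑ ys (λ y → ∑ xs (λ x → f x y))
∑-swap [] ys f = sym (∑-0 ys)
∑-swap (x ∷ xs) ys f rewrite ∑-swap xs ys f = sym (∑-+ ys (f x) _)

∑-map : (xs : List A) (g : A → B) (f : B → ℕ) → ∑ (map g xs) f ≡ ∑ xs (f ∘ g)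
∑-map xs g f = cong sum (sym (map-∘ xs))

∑-++ : (xs ys : List A) (f : A → ℕ) → ∑ (xs ++ ys) f ≡ ∑ xs f + ∑ ys f
∑-++ xs ys f = trans (cong sum (map-++ f xs ys)) (sum-++ (map f xs) (map f ys))

∑-concatMap : (xs : List A) (g : A → List B) (f : B → ℕ) → ∑ (concatMap g xs) f ≡ ∑ xs (λ x → ∑ (g x) f)
∑-concatMap [] g f = refl
∑-concatMap (x ∷ xs) g f = trans (∑-++ (g x) _ f) (cong (∑ (g x) f +_) (∑-concatMap xs g f))

∑-replicate : (n : ℕ) (x : A) (f : A → ℕ) → ∑ (replicate n x) f ≡ n * f x
∑-replicate zero x f = refl
∑-replicate (suc n) x f = cong (f x +_) (∑-replicate n x f)

∑-filter : (p : A → Bool) (xs : List A) (f : A → ℕ) → ∑ (filterᵇ p xs) f ≡ ∑ xs (λ x → ⟦ p x ⟧ * f x)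
∑-filter p [] f = refl
∑-filter p (x ∷ xs) f with p x
... | true = cong₂ _+_ (sym (+-identityʳ _)) (∑-filter p xs f)
... | false = ∑-filter p xs f

∑-cartesianProduct : (xs : List A) (ys : List B) (f : A × B → ℕ) →
                     ∑ (cartesianProduct xs ys) f ≡ ∑ xs (λ x → ∑ ys (λ y → f (x , y)))
∑-cartesianProduct [] ys f = refl
∑-cartesianProduct (x ∷ xs) ys f =
  trans (∑-++ (map (x ,_) ys) _ f) (cong₂ _+_ (∑-map ys (x ,_) f) (∑-cartesianProduct xs ys f))

∑-↭ : {xs ys : List A} (f : A → ℕ) → xs ↭ ys → ∑ xs f ≡ ∑ ys f
∑-↭ f p = sum-↭ (map⁺ f p)

length≡∑ : (xs : List A) → length xs ≡ ∑ xs (λ _ → 1)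
length≡∑ xs = sym (trans (∑-const xs 1) (*-identityʳ _))

map-proj₁-zip : (xs : List A) (ys : List B) → length xs ≡ length ys → map proj₁ (zip xs ys) ≡ xs
map-proj₁-zip [] [] eq = refl
map-proj₁-zip (x ∷ xs) (y ∷ ys) eq = cong (x ∷_) (map-proj₁-zip xs ys (suc-injective eq))

map-proj₂-zip : (xs : List A) (ys : List B) → length xs ≡ length ys → map proj₂ (zip xs ys) ≡ ys
map-proj₂-zip [] [] eq = refl
map-proj₂-zip (x ∷ xs) (y ∷ ys) eq = cong (y ∷_) (map-proj₂-zip xs ys (suc-injective eq))

module _ (_≟_ : DecidableEquality A) where

  private
    multiplicity : A → List A → ℕ
    multiplicity y xs = ∑ xs (λ x → ⟦ ⌊ x ≟ y ⌋ ⟧)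

    0<multiplicity⇒∈ : ∀ y xs → 1 ≤ multiplicity y xs → y ∈ xs
    0<multiplicity⇒∈ y (x ∷ xs) le with x ≟ y
    ... | yes refl = here refl
    ... | no _ = there (0<multiplicity⇒∈ y xs le)

  -- The counting arguments only ever give equal multiplicities; this converts them into a
  -- permutation, along which colors can be carried from one list to the other.
  sameMultiplicity⇒↭ : (xs ys : List A) →
    (∀ y → ∑ xs (λ x → ⟦ ⌊ x ≟ y ⌋ ⟧) ≡ ∑ ys (λ x → ⟦ ⌊ x ≟ y ⌋ ⟧)) → xs ↭ ys
  sameMultiplicity⇒↭ [] [] eq = refl
  sameMultiplicity⇒↭ [] (y ∷ ys) eq with eq y
  ... | eqy rewrite isYes-true (y ≟ y) refl with eqy
  ... | ()
  sameMultiplicity⇒↭ (x ∷ xs) ys eq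
    with 0<multiplicity⇒∈ x ys (≤-trans (subst (λ b → 1 ≤ ⟦ b ⟧ + multiplicity x xs)
           (sym (isYes-true (x ≟ x) refl)) (s≤s z≤n)) (≤-reflexive (eq x)))
  ... | x∈ys with ∈-∃++ x∈ys
  ... | as , bs , refl = ↭-trans (prep x (sameMultiplicity⇒↭ xs (as ++ bs) rest)) (↭-sym (shift x as bs))
    where
    rest : ∀ y → multiplicity y xs ≡ multiplicity y (as ++ bs)
    rest y = +-cancelˡ-≡ ⟦ ⌊ x ≟ y ⌋ ⟧ _ _ (trans (eq y) (∑-↭ _ (shift x as bs)))

∑-allFin-suc : ∀ n (f : Fin (suc n) → ℕ) → ∑ (allFin (suc n)) f ≡ f zero + ∑ (allFin n) (f ∘ suc)
∑-allFin-suc n f = cong (λ xs → f zero + sum xs)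
  (trans (map-tabulate suc f) (sym (map-tabulate id (f ∘ suc))))

∑-allFin-+ : ∀ m u (f : Fin (m + u) → ℕ) →
             ∑ (allFin (m + u)) f ≡ ∑ (allFin m) (λ x → f (x ↑ˡ u)) + ∑ (allFin u) (λ x → f (m ↑ʳ x))
∑-allFin-+ zero u f = refl
∑-allFin-+ (suc m) u f rewrite ∑-allFin-suc (m + u) f | ∑-allFin-suc m (λ x → f (x ↑ˡ u)) =
  trans (cong (f zero +_) (∑-allFin-+ m u (f ∘ suc))) (sym (+-assoc (f zero) _ _))

∑-allFin-const : ∀ n c → ∑ (allFin n) (λ _ → c) ≡ n * c
∑-allFin-const zero c = refl
∑-allFin-const (suc n) c = trans (∑-allFin-suc n (λ _ → c)) (cong (c +_) (∑-allFin-const n c))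

==-refl : ∀ {n} (i : Fin n) → (i == i) ≡ true
==-refl i = isYes-true (i Fin.≟ i) refl

==-≢ : ∀ {n} {i j : Fin n} → i ≢ j → (i == j) ≡ false
==-≢ {i = i} {j} = isYes-false (i Fin.≟ j)

==-cong : ∀ {n m} {i j : Fin n} {i′ j′ : Fin m} → (i ≡ j → i′ ≡ j′) → (i′ ≡ j′ → i ≡ j) → (i == j) ≡ (i′ == j′)
==-cong = isYes-cong _ _

==⇒≡ : ∀ {n} {i j : Fin n} → (i == j) ≡ true → i ≡ j
==⇒≡ = isYes⇒ _

==-sym : ∀ {n} (i j : Fin n) → (i == j) ≡ (j == i)
==-sym i j = ==-cong sym sym

∑-allFin-pick : ∀ {n} (i : Fin n) (f : Fin n → ℕ) → ∑ (allFin n) (λ j → ⟦ i == j ⟧ * f j) ≡ f i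
∑-allFin-pick {suc n} zero f rewrite ∑-allFin-suc n (λ j → ⟦ zero == j ⟧ * f j) =
  trans (cong₂ _+_ (+-identityʳ (f zero)) (∑-≡0 (allFin n) λ _ → refl)) (+-identityʳ _)
∑-allFin-pick {suc n} (suc i) f rewrite ∑-allFin-suc n (λ j → ⟦ suc i == j ⟧ * f j) =
  trans (∑-cong (allFin n) λ j → cong (λ b → ⟦ b ⟧ * f (suc j)) (==-cong {i = suc i} {suc j} {i} {j} (λ { refl → refl }) (cong suc)))
        (∑-allFin-pick i (f ∘ suc))

∑-allFin-indicator : ∀ {n} (i : Fin n) → ∑ (allFin n) (λ j → ⟦ i == j ⟧) ≡ 1
∑-allFin-indicator {n} i = trans (∑-cong (allFin n) (λ j → sym (*-identityʳ _))) (∑-allFin-pick i (λ _ → 1))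

-- Integral flows

∑-⟦⟧-∁ : {A : Set} (xs : List A) (p : A → Bool) → ∑ xs (λ x → ⟦ p x ⟧) + ∑ xs (λ x → ⟦ not (p x) ⟧) ≡ length xs
∑-⟦⟧-∁ [] p = refl
∑-⟦⟧-∁ (x ∷ xs) p with p x
... | true = cong suc (∑-⟦⟧-∁ xs p)
... | false = trans (+-suc _ _) (cong suc (∑-⟦⟧-∁ xs p))

⟦⟧-modular : ∀ b c → ⟦ b ∨ c ⟧ + ⟦ b ∧ c ⟧ ≡ ⟦ b ⟧ + ⟦ c ⟧
⟦⟧-modular true true = refl
⟦⟧-modular true false = refl
⟦⟧-modular false true = refl
⟦⟧-modular false false = refl

-- Submodularity of the cut function for a single arc: `b`, `c` say whether its tail lies in two
-- node sets, `b′`, `c′` whether its head does.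
⟦⟧-submodular : ∀ b c b′ c′ → ⟦ (b ∨ c) ∧ not (b′ ∨ c′) ⟧ + ⟦ (b ∧ c) ∧ not (b′ ∧ c′) ⟧
                            ≤ ⟦ b ∧ not b′ ⟧ + ⟦ c ∧ not c′ ⟧
⟦⟧-submodular true true true true = z≤n
⟦⟧-submodular true true true false = s≤s z≤n
⟦⟧-submodular true true false true = ≤-refl
⟦⟧-submodular true true false false = ≤-refl
⟦⟧-submodular true false true true = z≤n
⟦⟧-submodular true false true false = z≤n
⟦⟧-submodular true false false true = z≤n
⟦⟧-submodular true false false false = ≤-refl
⟦⟧-submodular false true true true = z≤n
⟦⟧-submodular false true true false = z≤n
⟦⟧-submodular false true false true = z≤n
⟦⟧-submodular false true false false = ≤-refl
⟦⟧-submodular false false _ _ = z≤n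

-- Arcs have capacity 1 and may be parallel. Supplies `s` and demands `t` are lists of nodes, a node
-- occurring once per unit. Sending a unit along an arc then amounts to a new demand at its tail and
-- a new supply at its head, so a used arc can be deleted from the network.
module IntegralFlow {N : ℕ} {A : Set} (tail head : A → Fin N) where

  NodeSet : Set
  NodeSet = Fin N → Bool

  weight : List (Fin N) → NodeSet → ℕ
  weight s R = ∑ s (λ v → ⟦ R v ⟧)

  cut : List A → NodeSet → ℕ
  cut xs R = ∑ xs (λ x → ⟦ R (tail x) ∧ not (R (head x)) ⟧)

  _∪_ _∩_ : NodeSet → NodeSet → NodeSet
  (R ∪ S) v = R v ∨ S v
  (R ∩ S) v = R v ∧ S v

  CutCondition : List A → List (Fin N) → List (Fin N) → Set
  CutCondition xs s t = ∀ R → weight s R ≤ weight t R + cut xs R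

  inflow outflow : List (A × Bool) → Fin N → ℕ
  inflow zs v = ∑ zs (λ z → ⟦ (head (proj₁ z) == v) ∧ proj₂ z ⟧)
  outflow zs v = ∑ zs (λ z → ⟦ (tail (proj₁ z) == v) ∧ proj₂ z ⟧)

  Flow : List A → List (Fin N) → List (Fin N) → Set
  Flow xs s t = Σ[ zs ∈ List (A × Bool) ] (map proj₁ zs ≡ xs
    × (∀ v → weight s (_== v) + inflow zs v ≡ weight t (_== v) + outflow zs v))

  weight-modular : ∀ s R S → weight s (R ∪ S) + weight s (R ∩ S) ≡ weight s R + weight s S
  weight-modular s R S = trans (sym (∑-+ s _ _))
    (trans (∑-cong s (λ v → ⟦⟧-modular (R v) (S v))) (∑-+ s _ _))

  cut-submodular : ∀ xs R S → cut xs (R ∪ S) + cut xs (R ∩ S) ≤ cut xs R + cut xs S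
  cut-submodular xs R S = begin
    cut xs (R ∪ S) + cut xs (R ∩ S) ≡⟨ ∑-+ xs _ _ ⟨
    ∑ xs _                           ≤⟨ ∑-mono xs (λ x → ⟦⟧-submodular (R (tail x)) (S (tail x)) (R (head x)) (S (head x))) ⟩
    ∑ xs _                           ≡⟨ ∑-+ xs _ _ ⟩
    cut xs R + cut xs S              ∎
    where open ≤-Reasoning

  Violates : List A → List (Fin N) → List (Fin N) → NodeSet → Set
  Violates xs s t R = weight t R + cut xs R < weight s R

  -- Only vectors of Booleans can be searched exhaustively; a node set given as a function is
  -- replaced by its table, with pointwise equality in place of extensionality.
  cutCondition? : ∀ xs s t → CutCondition xs s t ⊎ Σ[ R ∈ NodeSet ] Violates xs s t R
  cutCondition? xs s t with anySubset? {P = λ v → Violates xs s t (Vec.lookup v)} (λ v → _ <? _)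
  ... | yes (R , viol) = inj₂ (Vec.lookup R , viol)
  ... | no none = inj₁ λ R → ≮⇒≥ λ viol → none (Vec.tabulate R ,
        subst₂ _<_ (cong₂ _+_ (∑-cong t λ v → cong ⟦_⟧ (tab R v))
                              (∑-cong xs λ x → cong₂ (λ b c → ⟦ b ∧ not c ⟧) (tab R (tail x)) (tab R (head x))))
                   (∑-cong s λ v → cong ⟦_⟧ (tab R v)) viol)
    where
    tab : ∀ R v → R v ≡ Vec.lookup (Vec.tabulate R) v
    tab R v = sym (lookup∘tabulate R v)

  -- If leaving out the arc violates the condition at R, then R separates its ends, and submodularity at
  -- R ∪ S and R ∩ S (which do not) makes up for the unit that using the arc costs at S.
  useArc : ∀ x xs s t R → CutCondition (x ∷ xs) s t → Violates xs s t R →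
           CutCondition xs (head x ∷ s) (tail x ∷ t)
  useArc x xs s t R cond viol S with R (tail x) | R (head x) | S (tail x) | S (head x)
                                   | cond R | cond S | cond (R ∪ S) | cond (R ∩ S)
  ... | false | _ | _ | _ | c | _ | _ | _ = ⊥-elim (<⇒≱ viol c)
  ... | true | true | _ | _ | c | _ | _ | _ = ⊥-elim (<⇒≱ viol c)
  ... | true | false | true | false | _ | c | _ | _ = ≤-trans c (≤-reflexive (+-suc _ _))
  ... | true | false | true | true | _ | c | _ | _ = s≤s c
  ... | true | false | false | false | _ | c | _ | _ = c
  ... | true | false | false | true | _ | _ | c∪ | c∩ =
    +-cancelˡ-≤ (weight t R + cut xs R) _ _ (begin
      (weight t R + cut xs R) + suc (weight s S)                              ≡⟨ +-suc _ _ ⟩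
      suc (weight t R + cut xs R) + weight s S                                ≤⟨ +-monoˡ-≤ (weight s S) viol ⟩
      weight s R + weight s S                                                 ≡⟨ weight-modular s R S ⟨
      weight s (R ∪ S) + weight s (R ∩ S)                                     ≤⟨ +-mono-≤ c∪ c∩ ⟩
      (weight t (R ∪ S) + cut xs (R ∪ S)) + (weight t (R ∩ S) + cut xs (R ∩ S)) ≡⟨ shuffle (weight t (R ∪ S)) _ _ _ ⟩
      (weight t (R ∪ S) + weight t (R ∩ S)) + (cut xs (R ∪ S) + cut xs (R ∩ S)) ≤⟨ +-mono-≤ (≤-reflexive (weight-modular t R S)) (cut-submodular xs R S) ⟩
      (weight t R + weight t S) + (cut xs R + cut xs S)                       ≡⟨ shuffle (weight t R) _ _ _ ⟩
      (weight t R + cut xs R) + (weight t S + cut xs S)                       ∎)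
    where
    open ≤-Reasoning
    shuffle : ∀ a b c d → (a + b) + (c + d) ≡ (a + c) + (b + d)
    shuffle = solve-∀

  -- Induction on the arcs: an arc is discarded if the cut condition survives without it, and used
  -- otherwise. When no arcs are left, the condition bounds `s` by `t` on every set; on complements,
  -- with the comparison of lengths, it also gives the reverse bound, so supplies and demands
  -- coincide.
  flow : ∀ xs s t → length t ≤ length s → CutCondition xs s t → Flow xs s t
  flow [] s t len cond = [] , refl , λ v → cong (_+ 0) (≤-antisym (below (_== v)) (above (_== v)))
    where
    below : ∀ R → weight s R ≤ weight t R
    below R = ≤-trans (cond R) (≤-reflexive (+-identityʳ _))
    above : ∀ R → weight t R ≤ weight s R
    above R = +-cancelʳ-≤ (weight t (λ v → not (R v))) _ _ (begin
      weight t R + weight t (λ v → not (R v)) ≡⟨ ∑-⟦⟧-∁ t R ⟩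
      length t                                ≤⟨ len ⟩
      length s                                ≡⟨ ∑-⟦⟧-∁ s R ⟨
      weight s R + weight s (λ v → not (R v)) ≤⟨ +-monoʳ-≤ (weight s R) (below (λ v → not (R v))) ⟩
      weight s R + weight t (λ v → not (R v)) ∎)
      where open ≤-Reasoning
  flow (x ∷ xs) s t len cond with cutCondition? xs s t
  ... | inj₁ cond′ with flow xs s t len cond′
  ... | zs , eq , bal = (x , false) ∷ zs , cong (x ∷_) eq , λ v → bal′ v (head x == v) (tail x == v)
    where
    bal′ : ∀ v b c → weight s (_== v) + (⟦ b ∧ false ⟧ + inflow zs v) ≡ weight t (_== v) + (⟦ c ∧ false ⟧ + outflow zs v)
    bal′ v true true = bal v
    bal′ v true false = bal v
    bal′ v false true = bal v
    bal′ v false false = bal v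
  flow (x ∷ xs) s t len cond | inj₂ (R , viol)
    with flow xs (head x ∷ s) (tail x ∷ t) (s≤s len) (useArc x xs s t R cond viol)
  ... | zs , eq , bal = (x , true) ∷ zs , cong (x ∷_) eq , λ v → bal′ v (head x == v) (tail x == v) (bal v)
    where
    shuffle : ∀ a b c → b + (a + c) ≡ (a + b) + c
    shuffle = solve-∀
    bal′ : ∀ v b c → (⟦ b ⟧ + weight s (_== v)) + inflow zs v ≡ (⟦ c ⟧ + weight t (_== v)) + outflow zs v →
           weight s (_== v) + (⟦ b ∧ true ⟧ + inflow zs v) ≡ weight t (_== v) + (⟦ c ∧ true ⟧ + outflow zs v)
    bal′ v b c eq rewrite Bool.∧-identityʳ b | Bool.∧-identityʳ c = trans (shuffle ⟦ b ⟧ _ _) (trans eq (sym (shuffle ⟦ c ⟧ _ _)))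

-- Triples of V ∪ U

triple-≡ : {x y z x′ y′ z′ : Fin n} {p : x <ᶠ y} {q : y <ᶠ z} {p′ : x′ <ᶠ y′} {q′ : y′ <ᶠ z′} →
           x ≡ x′ → y ≡ y′ → z ≡ z′ → triple x y z p q ≡ triple x′ y′ z′ p′ q′
triple-≡ refl refl refl = cong₂ (triple _ _ _) (<-irrelevant _ _) (<-irrelevant _ _)

pair-≡ : {x y x′ y′ : Fin n} {p : x <ᶠ y} {p′ : x′ <ᶠ y′} → x ≡ x′ → y ≡ y′ → pair x y p ≡ pair x′ y′ p′
pair-≡ refl refl = cong (pair _ _) (<-irrelevant _ _)

-- A guard whose value may use the proof of the condition. It turns a sum over increasing tuples
-- into a sum over all tuples, which can be split coordinate by coordinate.
when : Dec P → (P → ℕ) → ℕ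
when (yes p) f = f p
when (no _) f = 0

when-yes : (d : Dec P) {f : P → ℕ} {c : ℕ} → P → (∀ p → f p ≡ c) → when d f ≡ c
when-yes (yes p) _ eq = eq p
when-yes (no ¬p) p _ = ⊥-elim (¬p p)

when-no : (d : Dec P) {f : P → ℕ} → ¬ P → when d f ≡ 0
when-no (yes p) ¬p = ⊥-elim (¬p p)
when-no (no _) _ = refl

when-⇔ : (d : Dec P) (d′ : Dec Q) {f : P → ℕ} {g : Q → ℕ} → (P → Q) → (Q → P) →
         (∀ p q → f p ≡ g q) → when d f ≡ when d′ g
when-⇔ (yes p) d′ to from eq = sym (when-yes d′ (to p) (λ q → sym (eq p q)))
when-⇔ (no ¬p) d′ to from eq = sym (when-no d′ (¬p ∘ from))

∑-when : {A : Set} (xs : List A) (d : Dec P) (f : A → P → ℕ) →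
         ∑ xs (λ x → when d (f x)) ≡ when d (λ p → ∑ xs (λ x → f x p))
∑-when xs (yes p) f = refl
∑-when xs (no _) f = ∑-0 xs

private
  -- The where-bound functions of allTriples and allPairs have no name here: unification recovers them.
  tripleIfSorted : ∀ n → Σ[ mk ∈ (Fin n → Fin n → Fin n → List (Triple n)) ]
    allTriples n ≡ concatMap (λ x → concatMap (λ y → concatMap (λ z → mk x y z) (allFin n)) (allFin n)) (allFin n)
  tripleIfSorted n = _ , refl

  ∑-tripleIfSorted : (F : Triple n → ℕ) (x y z : Fin n) → ∑ (proj₁ (tripleIfSorted n) x y z) F ≡
    when (x <?ᶠ y) λ p → when (y <?ᶠ z) λ q → F (triple x y z p q)
  ∑-tripleIfSorted F x y z with x <?ᶠ y | y <?ᶠ z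
  ... | yes p | yes q = +-identityʳ _
  ... | yes p | no _ = refl
  ... | no _ | yes _ = refl
  ... | no _ | no _ = refl

  pairIfSorted : ∀ n → Σ[ mk ∈ (Fin n → Fin n → List (Pair n)) ]
    allPairs n ≡ concatMap (λ x → concatMap (λ y → mk x y) (allFin n)) (allFin n)
  pairIfSorted n = _ , refl

  ∑-pairIfSorted : (F : Pair n → ℕ) (x y : Fin n) → ∑ (proj₁ (pairIfSorted n) x y) F ≡
    when (x <?ᶠ y) λ p → F (pair x y p)
  ∑-pairIfSorted F x y with x <?ᶠ y
  ... | yes p = +-identityʳ _
  ... | no _ = refl

∑-allTriples : (F : Triple n → ℕ) → ∑ (allTriples n) F ≡
  ∑ (allFin n) λ x → ∑ (allFin n) λ y → ∑ (allFin n) λ z →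
    when (x <?ᶠ y) λ p → when (y <?ᶠ z) λ q → F (triple x y z p q)
∑-allTriples {n} F =
  trans (∑-concatMap (allFin n) _ F) (∑-cong (allFin n) λ x →
  trans (∑-concatMap (allFin n) _ F) (∑-cong (allFin n) λ y →
  trans (∑-concatMap (allFin n) _ F) (∑-cong (allFin n) λ z → ∑-tripleIfSorted F x y z)))

∑-allPairs : (F : Pair n → ℕ) → ∑ (allPairs n) F ≡
  ∑ (allFin n) λ x → ∑ (allFin n) λ y → when (x <?ᶠ y) λ p → F (pair x y p)
∑-allPairs {n} F =
  trans (∑-concatMap (allFin n) _ F) (∑-cong (allFin n) λ x →
  trans (∑-concatMap (allFin n) _ F) (∑-cong (allFin n) λ y → ∑-pairIfSorted F x y))

module _ {m u : ℕ} where

  ↑ˡ-mono-< : {x y : Fin m} → x <ᶠ y → (x ↑ˡ u) <ᶠ (y ↑ˡ u)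
  ↑ˡ-mono-< {x} {y} = subst₂ _<_ (sym (toℕ-↑ˡ x u)) (sym (toℕ-↑ˡ y u))

  ↑ˡ-cancel-< : {x y : Fin m} → (x ↑ˡ u) <ᶠ (y ↑ˡ u) → x <ᶠ y
  ↑ˡ-cancel-< {x} {y} = subst₂ _<_ (toℕ-↑ˡ x u) (toℕ-↑ˡ y u)

  ↑ʳ-mono-< : {x y : Fin u} → x <ᶠ y → (m ↑ʳ x) <ᶠ (m ↑ʳ y)
  ↑ʳ-mono-< {x} {y} p = subst₂ _<_ (sym (toℕ-↑ʳ m x)) (sym (toℕ-↑ʳ m y)) (+-monoʳ-< m p)

  ↑ʳ-cancel-< : {x y : Fin u} → (m ↑ʳ x) <ᶠ (m ↑ʳ y) → x <ᶠ y
  ↑ʳ-cancel-< {x} {y} p = +-cancelˡ-< m _ _ (subst₂ _<_ (toℕ-↑ʳ m x) (toℕ-↑ʳ m y) p)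

  ↑ˡ<↑ʳ : (x : Fin m) (y : Fin u) → (x ↑ˡ u) <ᶠ (m ↑ʳ y)
  ↑ˡ<↑ʳ x y = subst₂ _<_ (sym (toℕ-↑ˡ x u)) (sym (toℕ-↑ʳ m y)) (≤-trans (toℕ<n x) (m≤m+n m _))

  ↑ʳ≮↑ˡ : (x : Fin u) (y : Fin m) → ¬ (m ↑ʳ x) <ᶠ (y ↑ˡ u)
  ↑ʳ≮↑ˡ x y p = <-asym p (↑ˡ<↑ʳ y x)

  -- V is the first m vertices and U the last u; the index counts the vertices in V.
  tripleV₃ : Triple m → Triple (m + u)
  tripleV₃ (triple x y z p q) = triple (x ↑ˡ u) (y ↑ˡ u) (z ↑ˡ u) (↑ˡ-mono-< p) (↑ˡ-mono-< q)

  tripleV₂ : Pair m → Fin u → Triple (m + u)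
  tripleV₂ (pair x y p) t = triple (x ↑ˡ u) (y ↑ˡ u) (m ↑ʳ t) (↑ˡ-mono-< p) (↑ˡ<↑ʳ y t)

  tripleV₁ : Fin m → Pair u → Triple (m + u)
  tripleV₁ x (pair y z q) = triple (x ↑ˡ u) (m ↑ʳ y) (m ↑ʳ z) (↑ˡ<↑ʳ x y) (↑ʳ-mono-< q)

  tripleV₀ : Triple u → Triple (m + u)
  tripleV₀ (triple x y z p q) = triple (m ↑ʳ x) (m ↑ʳ y) (m ↑ʳ z) (↑ʳ-mono-< p) (↑ʳ-mono-< q)

  pairV₂ : Pair m → Pair (m + u)
  pairV₂ (pair x y p) = pair (x ↑ˡ u) (y ↑ˡ u) (↑ˡ-mono-< p)

  pairV₁ : Fin m → Fin u → Pair (m + u)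
  pairV₁ x y = pair (x ↑ˡ u) (m ↑ʳ y) (↑ˡ<↑ʳ x y)

  pairV₀ : Pair u → Pair (m + u)
  pairV₀ (pair x y p) = pair (m ↑ʳ x) (m ↑ʳ y) (↑ʳ-mono-< p)

  ∑-allPairs-split : (F : Pair (m + u) → ℕ) → ∑ (allPairs (m + u)) F ≡
    ∑ (allPairs m) (F ∘ pairV₂) + ∑ (allFin m) (λ x → ∑ (allFin u) (F ∘ pairV₁ x)) + ∑ (allPairs u) (F ∘ pairV₀)
  ∑-allPairs-split F = trans (∑-allPairs F) (trans (∑-allFin-+ m u _) (cong₂ _+_
    (trans (∑-cong (allFin m) λ x → trans (∑-allFin-+ m u _) (cong₂ _+_
       (∑-cong (allFin m) λ y → when-⇔ ((x ↑ˡ u) <?ᶠ (y ↑ˡ u)) (x <?ᶠ y) ↑ˡ-cancel-< ↑ˡ-mono-< λ p q → cong F (pair-≡ refl refl))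
       (∑-cong (allFin u) λ y → when-yes ((x ↑ˡ u) <?ᶠ (m ↑ʳ y)) (↑ˡ<↑ʳ x y) λ p → cong F (pair-≡ refl refl))))
      (trans (∑-+ (allFin m) _ _) (cong₂ _+_ (sym (∑-allPairs (F ∘ pairV₂))) refl)))
    (trans (∑-cong (allFin u) λ x → trans (∑-allFin-+ m u _) (cong₂ _+_
       (∑-≡0 (allFin m) λ y → when-no ((m ↑ʳ x) <?ᶠ (y ↑ˡ u)) (↑ʳ≮↑ˡ x y))
       (∑-cong (allFin u) λ y → when-⇔ ((m ↑ʳ x) <?ᶠ (m ↑ʳ y)) (x <?ᶠ y) ↑ʳ-cancel-< ↑ʳ-mono-< λ p q → cong F (pair-≡ refl refl))))
      (sym (∑-allPairs (F ∘ pairV₀))))))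

  -- An increasing triple lists its vertices in V first. Of the eight ways to distribute the
  -- coordinates over V and U, the four with a vertex of U before one of V contribute 0: they are
  -- `lrl`, `rrl`, and the two covered by `rl`.
  ∑-allTriples-split : (F : Triple (m + u) → ℕ) → ∑ (allTriples (m + u)) F ≡
    (∑ (allTriples m) (F ∘ tripleV₃) + ∑ (allPairs m) (λ S → ∑ (allFin u) (F ∘ tripleV₂ S)))
    + (∑ (allFin m) (λ x → ∑ (allPairs u) (F ∘ tripleV₁ x)) + ∑ (allTriples u) (F ∘ tripleV₀))
  ∑-allTriples-split F = trans (∑-allTriples F) (trans (∑-allFin-+ m u _)
    (trans (cong₂ _+_
      (trans (∑-cong (allFin m) λ x → trans (∑-allFin-+ m u _) (cong₂ _+_
          (trans (∑-cong (allFin m) λ y → trans (∑-allFin-+ m u _) (cong₂ _+_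
             (∑-cong (allFin m) λ z → case₃ x y z)
             (trans (∑-cong (allFin u) λ z → case₂ x y z) (∑-when (allFin u) (x <?ᶠ y) _))))
            (∑-+ (allFin m) _ _))
          (trans (∑-cong (allFin u) λ y → trans (∑-allFin-+ m u _) (cong₂ _+_
             (∑-≡0 (allFin m) (lrl x y))
             (∑-cong (allFin u) λ z → case₁ x y z)))
            (sym (∑-allPairs (F ∘ tripleV₁ x))))))
        (trans (∑-+ (allFin m) _ _) (cong₂ _+_ (trans (∑-+ (allFin m) _ _)
          (cong₂ _+_ (sym (∑-allTriples (F ∘ tripleV₃))) (sym (∑-allPairs (λ S → ∑ (allFin u) (F ∘ tripleV₂ S)))))) refl)))
      (trans (∑-cong (allFin u) λ x → trans (∑-allFin-+ m u _) (cong₂ _+_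
          (∑-≡0 (allFin m) λ y → ∑-≡0 (allFin (m + u)) (rl x y))
          (∑-cong (allFin u) λ y → trans (∑-allFin-+ m u _) (cong₂ _+_
             (∑-≡0 (allFin m) (rrl x y))
             (∑-cong (allFin u) λ z → case₀ x y z)))))
        (sym (∑-allTriples (F ∘ tripleV₀)))))
    (+-assoc (∑ (allTriples m) (F ∘ tripleV₃) + ∑ (allPairs m) (λ S → ∑ (allFin u) (F ∘ tripleV₂ S))) _ _)))
    where
    F′ : ∀ x y z → ℕ
    F′ x y z = when (x <?ᶠ y) λ p → when (y <?ᶠ z) λ q → F (triple x y z p q)
    case₃ : ∀ x y z → F′ (x ↑ˡ u) (y ↑ˡ u) (z ↑ˡ u) ≡
            when (x <?ᶠ y) λ p → when (y <?ᶠ z) λ q → F (tripleV₃ (triple x y z p q))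
    case₃ x y z = when-⇔ ((x ↑ˡ u) <?ᶠ (y ↑ˡ u)) (x <?ᶠ y) ↑ˡ-cancel-< ↑ˡ-mono-< λ p p′ → when-⇔ ((y ↑ˡ u) <?ᶠ (z ↑ˡ u)) (y <?ᶠ z) ↑ˡ-cancel-< ↑ˡ-mono-< λ q q′ →
      cong F (triple-≡ refl refl refl)
    case₂ : ∀ x y z → F′ (x ↑ˡ u) (y ↑ˡ u) (m ↑ʳ z) ≡ when (x <?ᶠ y) λ p → F (tripleV₂ (pair x y p) z)
    case₂ x y z = when-⇔ ((x ↑ˡ u) <?ᶠ (y ↑ˡ u)) (x <?ᶠ y) ↑ˡ-cancel-< ↑ˡ-mono-< λ p p′ → when-yes ((y ↑ˡ u) <?ᶠ (m ↑ʳ z)) (↑ˡ<↑ʳ y z) λ q →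
      cong F (triple-≡ refl refl refl)
    case₁ : ∀ x y z → F′ (x ↑ˡ u) (m ↑ʳ y) (m ↑ʳ z) ≡ when (y <?ᶠ z) λ q → F (tripleV₁ x (pair y z q))
    case₁ x y z = when-yes ((x ↑ˡ u) <?ᶠ (m ↑ʳ y)) (↑ˡ<↑ʳ x y) λ p → when-⇔ ((m ↑ʳ y) <?ᶠ (m ↑ʳ z)) (y <?ᶠ z) ↑ʳ-cancel-< ↑ʳ-mono-< λ q q′ →
      cong F (triple-≡ refl refl refl)
    case₀ : ∀ x y z → F′ (m ↑ʳ x) (m ↑ʳ y) (m ↑ʳ z) ≡
            when (x <?ᶠ y) λ p → when (y <?ᶠ z) λ q → F (tripleV₀ (triple x y z p q))
    case₀ x y z = when-⇔ ((m ↑ʳ x) <?ᶠ (m ↑ʳ y)) (x <?ᶠ y) ↑ʳ-cancel-< ↑ʳ-mono-< λ p p′ → when-⇔ ((m ↑ʳ y) <?ᶠ (m ↑ʳ z)) (y <?ᶠ z) ↑ʳ-cancel-< ↑ʳ-mono-< λ q q′ →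
      cong F (triple-≡ refl refl refl)
    lrl : ∀ x y z → F′ (x ↑ˡ u) (m ↑ʳ y) (z ↑ˡ u) ≡ 0
    lrl x y z = when-yes ((x ↑ˡ u) <?ᶠ (m ↑ʳ y)) (↑ˡ<↑ʳ x y) λ p → when-no ((m ↑ʳ y) <?ᶠ (z ↑ˡ u)) (↑ʳ≮↑ˡ y z)
    rl : ∀ x y z → F′ (m ↑ʳ x) (y ↑ˡ u) z ≡ 0
    rl x y z = when-no ((m ↑ʳ x) <?ᶠ (y ↑ˡ u)) (↑ʳ≮↑ˡ x y)
    rrl : ∀ x y z → F′ (m ↑ʳ x) (m ↑ʳ y) (z ↑ˡ u) ≡ 0
    rrl x y z with (m ↑ʳ x) <?ᶠ (m ↑ʳ y)
    ... | yes _ = when-no ((m ↑ʳ y) <?ᶠ (z ↑ˡ u)) (↑ʳ≮↑ˡ y z)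
    ... | no _ = refl

-- Numbers of pairs and triples

#pairs #triples : ℕ → ℕ
#pairs n = ∑ (allPairs n) (λ _ → 1)
#triples n = ∑ (allTriples n) (λ _ → 1)

-- Splitting off a single vertex, with `m = 1`, separates the pairs that contain it from those that
-- do not. The same split gives the recursion for triples and the incidence counts at `zero`.
#pairs-suc : ∀ n → #pairs (suc n) ≡ n + #pairs n
#pairs-suc n = trans (∑-allPairs-split {1} {n} (λ _ → 1))
  (cong (_+ #pairs n) (trans (+-identityʳ _) (trans (∑-allFin-const n 1) (*-identityʳ n))))

#triples-suc : ∀ n → #triples (suc n) ≡ #pairs n + #triples n
#triples-suc n = trans (∑-allTriples-split {1} {n} (λ _ → 1)) (cong (_+ #triples n) (+-identityʳ _))

#pairs≡nC2 : ∀ n → #pairs n ≡ n C 2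
#pairs≡nC2 zero = refl
#pairs≡nC2 (suc n) = trans (#pairs-suc n)
  (trans (cong₂ _+_ (sym (nC1≡n n)) (#pairs≡nC2 n)) (nCk+nC[k+1]≡[n+1]C[k+1] n 1))

2*#pairs : ∀ n → 2 * #pairs (suc n) ≡ suc n * n
2*#pairs zero = refl
2*#pairs (suc n) = trans (cong (2 *_) (#pairs-suc (suc n)))
  (trans (*-distribˡ-+ 2 (suc n) (#pairs (suc n))) (trans (cong (2 * suc n +_) (2*#pairs n)) (lemma n)))
  where
  lemma : ∀ n → 2 * suc n + suc n * n ≡ suc (suc n) * suc n
  lemma = solve-∀

-- Both sides count incidences of vertices with triples. Free of division, the identity serves
-- twice: to average over the triples inside the amalgamated set, and to compute the total size of
-- all color classes.
3*#triples : ∀ n → 3 * #triples (suc n) ≡ suc n * #pairs n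
3*#triples zero = refl
3*#triples (suc n) = begin
  3 * #triples (suc (suc n))                       ≡⟨ cong (3 *_) (#triples-suc (suc n)) ⟩
  3 * (#pairs (suc n) + #triples (suc n))          ≡⟨ *-distribˡ-+ 3 (#pairs (suc n)) _ ⟩
  3 * #pairs (suc n) + 3 * #triples (suc n)        ≡⟨ cong (3 * #pairs (suc n) +_) (3*#triples n) ⟩
  3 * #pairs (suc n) + suc n * #pairs n            ≡⟨ lemma₁ (#pairs (suc n)) n (#pairs n) ⟩
  #pairs (suc n) + (2 * #pairs (suc n) + suc n * #pairs n) ≡⟨ cong (λ p → #pairs (suc n) + (p + suc n * #pairs n)) (2*#pairs n) ⟩
  #pairs (suc n) + (suc n * n + suc n * #pairs n)  ≡⟨ cong (#pairs (suc n) +_) (*-distribˡ-+ (suc n) n (#pairs n)) ⟨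
  #pairs (suc n) + suc n * (n + #pairs n)          ≡⟨ cong (λ p → #pairs (suc n) + suc n * p) (#pairs-suc n) ⟨
  suc (suc n) * #pairs (suc n)                     ∎
  where
  open ≡-Reasoning
  lemma₁ : ∀ p n q → 3 * p + suc n * q ≡ p + (2 * p + suc n * q)
  lemma₁ = solve-∀

-- Incidences of vertices with pairs and triples

sumOver : (Fin n → ℕ) → Triple n → ℕ
sumOver f (triple a b c _ _) = f a + (f b + f c)

sumOver₂ : (Fin n → ℕ) → Pair n → ℕ
sumOver₂ f (pair a b _) = f a + f b

⟦∨⟧-disjoint : ∀ b c → (b ≡ true → c ≡ false) → ⟦ b ∨ c ⟧ ≡ ⟦ b ⟧ + ⟦ c ⟧
⟦∨⟧-disjoint true c disj rewrite disj refl = refl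
⟦∨⟧-disjoint false c disj = refl

⟦∈2⟧ : (v : Fin n) (e : Pair n) → ⟦ v ∈2 e ⟧ ≡ sumOver₂ (λ x → ⟦ v == x ⟧) e
⟦∈2⟧ v (pair a b a<b) = ⟦∨⟧-disjoint (v == a) (v == b) λ v≡a → ==-≢ λ v≡b →
  <⇒≢ a<b (cong toℕ (trans (sym (==⇒≡ v≡a)) v≡b))

⟦∈3⟧ : (v : Fin n) (e : Triple n) → ⟦ v ∈3 e ⟧ ≡ sumOver (λ x → ⟦ v == x ⟧) e
⟦∈3⟧ v (triple a b c a<b b<c) =
  trans (⟦∨⟧-disjoint (v == a) _ λ v≡a → cong₂ _∨_
           (==-≢ λ v≡b → <⇒≢ a<b (cong toℕ (trans (sym (==⇒≡ v≡a)) v≡b)))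
           (==-≢ λ v≡c → <⇒≢ (<-trans a<b b<c) (cong toℕ (trans (sym (==⇒≡ v≡a)) v≡c))))
        (cong (⟦ v == a ⟧ +_) (⟦∈2⟧ v (pair b c b<c)))

-- The handshake principle for one triple; with `f` constantly 1 it says that a triple has three
-- vertices. All exchanges between degree sums and hyperedge counts go through it.
∑-∈3 : (f : Fin n → ℕ) (e : Triple n) → ∑ (allFin n) (λ v → f v * ⟦ v ∈3 e ⟧) ≡ sumOver f e
∑-∈3 {n} f e@(triple a b c _ _) = begin
  ∑ (allFin n) (λ v → f v * ⟦ v ∈3 e ⟧)
    ≡⟨ ∑-cong (allFin n) (λ v → trans (cong (f v *_) (⟦∈3⟧ v e))
         (trans (distrib (f v) ⟦ v == a ⟧ ⟦ v == b ⟧ ⟦ v == c ⟧)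
           (cong₂ _+_ (flip v a) (cong₂ _+_ (flip v b) (flip v c))))) ⟩
  ∑ (allFin n) (λ v → at a v + (at b v + at c v))
    ≡⟨ trans (∑-+ (allFin n) (at a) _) (cong (∑ (allFin n) (at a) +_) (∑-+ (allFin n) (at b) (at c))) ⟩
  ∑ (allFin n) (at a) + (∑ (allFin n) (at b) + ∑ (allFin n) (at c))
    ≡⟨ cong₂ _+_ (∑-allFin-pick a f) (cong₂ _+_ (∑-allFin-pick b f) (∑-allFin-pick c f)) ⟩
  sumOver f e ∎
  where
  open ≡-Reasoning
  at : Fin n → Fin n → ℕ
  at x v = ⟦ x == v ⟧ * f v
  flip : ∀ v x → ⟦ v == x ⟧ * f v ≡ ⟦ x == v ⟧ * f v
  flip v x = cong (λ b → ⟦ b ⟧ * f v) (==-sym v x)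
  distrib : ∀ k x y z → k * (x + (y + z)) ≡ x * k + (y * k + z * k)
  distrib = solve-∀

module _ {m u : ℕ} where

  ↑ˡ-== : (x y : Fin m) → ((x ↑ˡ u) == (y ↑ˡ u)) ≡ (x == y)
  ↑ˡ-== x y = ==-cong (↑ˡ-injective u x y) (cong (_↑ˡ u))

  ↑ʳ-== : (x y : Fin u) → ((m ↑ʳ x) == (m ↑ʳ y)) ≡ (x == y)
  ↑ʳ-== x y = ==-cong (↑ʳ-injective m x y) (cong (m ↑ʳ_))

  ↑ˡ-==-↑ʳ : (x : Fin m) (y : Fin u) → ((x ↑ˡ u) == (m ↑ʳ y)) ≡ false
  ↑ˡ-==-↑ʳ x y = ==-≢ λ eq → <⇒≢ (↑ˡ<↑ʳ x y) (cong toℕ eq)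

  ↑ʳ-==-↑ˡ : (x : Fin u) (y : Fin m) → ((m ↑ʳ x) == (y ↑ˡ u)) ≡ false
  ↑ʳ-==-↑ˡ x y = trans (==-sym (m ↑ʳ x) (y ↑ˡ u)) (↑ˡ-==-↑ʳ y x)

∑-pairs∋0 : ∀ u → ∑ (allPairs (suc u)) (λ P → ⟦ zero ∈2 P ⟧) ≡ u
∑-pairs∋0 u = trans (∑-allPairs-split {1} {u} (λ P → ⟦ zero ∈2 P ⟧))
  (trans (cong₂ _+_ (trans (+-identityʳ _) (trans (∑-allFin-const u 1) (*-identityʳ u))) (∑-≡0 (allPairs u) λ { (pair _ _ _) → refl }))
         (+-identityʳ u))

∑-triples∋0 : ∀ u → ∑ (allTriples (suc u)) (λ T → ⟦ zero ∈3 T ⟧) ≡ #pairs u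
∑-triples∋0 u = trans (∑-allTriples-split {1} {u} (λ T → ⟦ zero ∈3 T ⟧))
  (trans (cong₂ _+_ (trans (+-identityʳ _) (∑-cong (allPairs u) λ { (pair _ _ _) → refl })) (∑-≡0 (allTriples u) λ { (triple _ _ _ _ _) → refl }))
         (+-identityʳ _))

<ᵇ-true : ∀ {a b} → suc a ≤ b → (a <ᵇ b) ≡ true
<ᵇ-true {zero} (s≤s _) = refl
<ᵇ-true {suc a} (s≤s p) = <ᵇ-true p

<ᵇ-false : ∀ {a b} → b ≤ a → (a <ᵇ b) ≡ false
<ᵇ-false {b = zero} _ = refl
<ᵇ-false (s≤s p) = <ᵇ-false p

-- Amalgamation of the vertices from `w` on

amalgamate : Fin n → Fin n → Fin n
amalgamate w x = if toℕ x <ᵇ toℕ w then x else w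

-- Marks the amalgamated vertices, `w` among them. `sumOver (outside w) e` is the numerator of the
-- fractional weight of `e`.
outside : Fin n → Fin n → ℕ
outside w x = ⟦ not (toℕ x <ᵇ toℕ w) ⟧

code : Fin n → Fin n → Fin n → Fin (n * (n * n))
code x y z = combine x (combine y z)

-- Amalgamation is monotone and `e` is increasing, so the ordered list of images determines and is
-- determined by their multiset. Packing it into one `Fin` lets classes serve as nodes of a flow
-- network.
key : Fin n → Triple n → Fin (n * (n * n))
key w (triple a b c _ _) = code (amalgamate w a) (amalgamate w b) (amalgamate w c)

amalgamate-< : ∀ {w x : Fin n} → suc (toℕ x) ≤ toℕ w → amalgamate w x ≡ x
amalgamate-< p rewrite <ᵇ-true p = refl

amalgamate-≥ : ∀ {w x : Fin n} → toℕ w ≤ toℕ x → amalgamate w x ≡ w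
amalgamate-≥ p rewrite <ᵇ-false p = refl

-- The vertices of `e` from `w` on are distinct, and there are only `n ∸ toℕ w` to choose from.
-- Hence fractional weights are at most 1, as the capacities demand.
sumOver-outside-≤ : (w : Fin n) (e : Triple n) → sumOver (outside w) e + toℕ w ≤ n
sumOver-outside-≤ {n} w (triple a b c a<b b<c)
  with toℕ a <? toℕ w | toℕ b <? toℕ w | toℕ c <? toℕ w
... | yes p | yes q | yes r rewrite <ᵇ-true p | <ᵇ-true q | <ᵇ-true r = <⇒≤ (toℕ<n w)
... | yes p | yes q | no r rewrite <ᵇ-true p | <ᵇ-true q | <ᵇ-false (≮⇒≥ r) = ≤-trans (s≤s (≮⇒≥ r)) (toℕ<n c)
... | yes p | no q | no r rewrite <ᵇ-true p | <ᵇ-false (≮⇒≥ q) | <ᵇ-false (≮⇒≥ r) =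
  ≤-trans (s≤s (≤-trans (s≤s (≮⇒≥ q)) b<c)) (toℕ<n c)
... | no p | no q | no r rewrite <ᵇ-false (≮⇒≥ p) | <ᵇ-false (≮⇒≥ q) | <ᵇ-false (≮⇒≥ r) =
  ≤-trans (s≤s (≤-trans (s≤s (≤-trans (s≤s (≮⇒≥ p)) a<b)) b<c)) (toℕ<n c)
... | no p | yes q | _ = ⊥-elim (p (<-trans a<b q))
... | _ | no q | yes r = ⊥-elim (q (<-trans b<c r))

module _ {M u : ℕ} where

  private
    w : Fin (M + suc u)
    w = M ↑ʳ zero

    ι′ : Fin M → Fin (M + suc u)
    ι′ x = x ↑ˡ suc u

    toℕ-w : toℕ w ≡ M
    toℕ-w = trans (toℕ-↑ʳ M zero) (+-identityʳ M)

    ι′<w : ∀ x → suc (toℕ (ι′ x)) ≤ toℕ w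
    ι′<w x = ↑ˡ<↑ʳ x zero

    w≤↑ʳ : (t : Fin (suc u)) → toℕ w ≤ toℕ (M ↑ʳ t)
    w≤↑ʳ t = subst₂ _≤_ (sym toℕ-w) (sym (toℕ-↑ʳ M t)) (m≤m+n M (toℕ t))

    outside-ι′ : ∀ x → outside w (ι′ x) ≡ 0
    outside-ι′ x = cong (⟦_⟧ ∘ not) (<ᵇ-true (ι′<w x))

    outside-↑ʳ : ∀ t → outside w (M ↑ʳ t) ≡ 1
    outside-↑ʳ t = cong (⟦_⟧ ∘ not) (<ᵇ-false (w≤↑ʳ t))

  module _ (H : Fin ((M + suc u) * ((M + suc u) * (M + suc u))) → ℕ) where

    private
      K₂ K₁ K₀ : ℕ
      K₂ = ∑ (allPairs M) (λ S → H (code (ι′ (Pair.a S)) (ι′ (Pair.b S)) w))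
      K₁ = ∑ (allFin M) (λ x → H (code (ι′ x) w w))
      K₀ = H (code w w w)

      key₂ : ∀ S t → key w (tripleV₂ {M} {suc u} S t) ≡ code (ι′ (Pair.a S)) (ι′ (Pair.b S)) w
      key₂ (pair x y _) t rewrite amalgamate-< (ι′<w x) | amalgamate-< (ι′<w y) | amalgamate-≥ (w≤↑ʳ t) = refl

      key₁ : ∀ x P → key w (tripleV₁ {M} {suc u} x P) ≡ code (ι′ x) w w
      key₁ x (pair y z _) rewrite amalgamate-< (ι′<w x) | amalgamate-≥ (w≤↑ʳ y) | amalgamate-≥ (w≤↑ʳ z) = refl

      key₀ : ∀ T → key w (tripleV₀ {M} {suc u} T) ≡ code w w w
      key₀ (triple x y z _ _) rewrite amalgamate-≥ (w≤↑ʳ x) | amalgamate-≥ (w≤↑ʳ y) | amalgamate-≥ (w≤↑ʳ z) = refl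

      -- The key of a triple forgets which amalgamated vertices it contains, so for each number of
      -- vertices before `w` the sum factors into a weight on the amalgamated part and a sum of `H`
      -- over classes. The index of `K₂`, `K₁`, `K₀` is the number of vertices before `w`; the
      -- triples with three of them have weight 0.
      ∑-by-key : (ω : Triple (M + suc u) → ℕ) (ω₂ : Fin (suc u) → ℕ) (ω₁ : Pair (suc u) → ℕ) (ω₀ : Triple (suc u) → ℕ) →
        (∀ S → ω (tripleV₃ {M} {suc u} S) ≡ 0) → (∀ S t → ω (tripleV₂ {M} {suc u} S t) ≡ ω₂ t) →
        (∀ x P → ω (tripleV₁ {M} {suc u} x P) ≡ ω₁ P) → (∀ T → ω (tripleV₀ {M} {suc u} T) ≡ ω₀ T) →
        ∑ (allTriples (M + suc u)) (λ e → ω e * H (key w e)) ≡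
        ∑ (allFin (suc u)) ω₂ * K₂ + (∑ (allPairs (suc u)) ω₁ * K₁ + ∑ (allTriples (suc u)) ω₀ * K₀)
      ∑-by-key ω ω₂ ω₁ ω₀ eq₃ eq₂ eq₁ eq₀ =
        trans (∑-allTriples-split {M} {suc u} (λ e → ω e * H (key w e))) (cong₂ _+_
          (cong₂ _+_
            (∑-≡0 (allTriples M) λ S → cong (_* H (key w (tripleV₃ {M} {suc u} S))) (eq₃ S))
            (trans (∑-cong (allPairs M) λ { S@(pair x y p) →
                trans (∑-cong (allFin (suc u)) λ t → cong₂ _*_ (eq₂ S t) (cong H (key₂ S t))) (∑-*ʳ (allFin (suc u)) _ ω₂) })
              (∑-*ˡ (allPairs M) (∑ (allFin (suc u)) ω₂) (λ S → H (code (ι′ (Pair.a S)) (ι′ (Pair.b S)) w)))))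
          (cong₂ _+_
            (trans (∑-cong (allFin M) λ x →
                trans (∑-cong (allPairs (suc u)) λ P → cong₂ _*_ (eq₁ x P) (cong H (key₁ x P))) (∑-*ʳ (allPairs (suc u)) _ ω₁))
              (∑-*ˡ (allFin M) (∑ (allPairs (suc u)) ω₁) _))
            (trans (∑-cong (allTriples (suc u)) λ T → cong₂ _*_ (eq₀ T) (cong H (key₀ T))) (∑-*ʳ (allTriples (suc u)) K₀ ω₀))))

      ∑-∋w : ∑ (allTriples (M + suc u)) (λ e → ⟦ w ∈3 e ⟧ * H (key w e)) ≡ 1 * K₂ + (u * K₁ + #pairs u * K₀)
      ∑-∋w = trans
        (∑-by-key (λ e → ⟦ w ∈3 e ⟧) (λ t → ⟦ zero == t ⟧) (λ P → ⟦ zero ∈2 P ⟧) (λ T → ⟦ zero ∈3 T ⟧)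
          (λ { (triple x y z _ _) → cong ⟦_⟧ (cong₂ _∨_ (↑ʳ-==-↑ˡ zero x) (cong₂ _∨_ (↑ʳ-==-↑ˡ zero y) (↑ʳ-==-↑ˡ zero z))) })
          (λ { (pair x y _) t → cong ⟦_⟧ (cong₂ _∨_ (↑ʳ-==-↑ˡ zero x) (cong₂ _∨_ (↑ʳ-==-↑ˡ zero y) (↑ʳ-== {M} zero t))) })
          (λ { x (pair y z _) → cong ⟦_⟧ (cong₂ _∨_ (↑ʳ-==-↑ˡ zero x) (cong₂ _∨_ (↑ʳ-== {M} zero y) (↑ʳ-== {M} zero z))) })
          (λ { (triple x y z _ _) → cong ⟦_⟧ (cong₂ _∨_ (↑ʳ-== {M} zero x) (cong₂ _∨_ (↑ʳ-== {M} zero y) (↑ʳ-== {M} zero z))) }))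
        (cong₂ _+_ (cong (_* K₂) (∑-allFin-indicator {suc u} zero))
          (cong₂ _+_ (cong (_* K₁) (∑-pairs∋0 u)) (cong (_* K₀) (∑-triples∋0 u))))

      ∑-outside : ∑ (allTriples (M + suc u)) (λ e → sumOver (outside w) e * H (key w e)) ≡
                  (suc u * 1) * K₂ + ((2 * #pairs (suc u)) * K₁ + (3 * #triples (suc u)) * K₀)
      ∑-outside = trans
        (∑-by-key (sumOver (outside w)) (λ _ → 1) (λ _ → 2) (λ _ → 3)
          (λ { (triple x y z _ _) → cong₂ _+_ (outside-ι′ x) (cong₂ _+_ (outside-ι′ y) (outside-ι′ z)) })
          (λ { (pair x y _) t → cong₂ _+_ (outside-ι′ x) (cong₂ _+_ (outside-ι′ y) (outside-↑ʳ t)) })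
          (λ { x (pair y z _) → cong₂ _+_ (outside-ι′ x) (cong₂ _+_ (outside-↑ʳ y) (outside-↑ʳ z)) })
          (λ { (triple x y z _ _) → cong₂ _+_ (outside-↑ʳ x) (cong₂ _+_ (outside-↑ʳ y) (outside-↑ʳ z)) }))
        (cong₂ _+_ (cong (_* K₂) (∑-allFin-const (suc u) 1))
          (cong₂ _+_ (cong (_* K₁) (∑-*ˡ (allPairs (suc u)) 2 (λ _ → 1))) (cong (_* K₀) (∑-*ˡ (allTriples (suc u)) 3 (λ _ → 1)))))

    -- Within a class of triples with the same amalgamation, each of the suc u amalgamated vertices is
    -- incident with equally many.
    ∑-∋w-average : suc u * ∑ (allTriples (M + suc u)) (λ e → ⟦ w ∈3 e ⟧ * H (key w e))
                   ≡ ∑ (allTriples (M + suc u)) (λ e → sumOver (outside w) e * H (key w e))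
    ∑-∋w-average = begin
      suc u * ∑ (allTriples (M + suc u)) (λ e → ⟦ w ∈3 e ⟧ * H (key w e)) ≡⟨ cong (suc u *_) ∑-∋w ⟩
      suc u * (1 * K₂ + (u * K₁ + #pairs u * K₀))                            ≡⟨ lemma (suc u) K₂ u K₁ (#pairs u) K₀ ⟩
      (suc u * 1) * K₂ + ((suc u * u) * K₁ + (suc u * #pairs u) * K₀)
        ≡⟨ cong₂ (λ p t → (suc u * 1) * K₂ + (p * K₁ + t * K₀)) (2*#pairs u) (3*#triples u) ⟨
      (suc u * 1) * K₂ + ((2 * #pairs (suc u)) * K₁ + (3 * #triples (suc u)) * K₀) ≡⟨ ∑-outside ⟨
      ∑ (allTriples (M + suc u)) (λ e → sumOver (outside w) e * H (key w e)) ∎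
      where
      open ≡-Reasoning
      lemma : ∀ s a u b p c → s * (1 * a + (u * b + p * c)) ≡ (s * 1) * a + ((s * u) * b + (s * p) * c)
      lemma = solve-∀

-- Vertex splitting

-- A `zip` that keeps, entry by entry, the proof that the two partners have the same image.
align : {X Y Z : Set} (f : X → Z) (g : Y → Z) (xs : List X) (ys : List Y) → map f xs ≡ map g ys →
        Σ[ ps ∈ List (Σ[ p ∈ X × Y ] f (proj₁ p) ≡ g (proj₂ p)) ]
          (map (proj₁ ∘ proj₁) ps ≡ xs) × (map (proj₂ ∘ proj₁) ps ≡ ys)
align f g [] [] eq = [] , refl , refl
align f g (x ∷ xs) (y ∷ ys) eq with ∷-injective eq
... | fx≡gy , eqs with align f g xs ys eqs
... | ps , refl , refl = ((x , y) , fx≡gy) ∷ ps , refl , refl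

⟦∧⟧+⟦∧not⟧ : ∀ a b → ⟦ a ∧ b ⟧ + ⟦ a ∧ not b ⟧ ≡ ⟦ a ⟧
⟦∧⟧+⟦∧not⟧ true true = refl
⟦∧⟧+⟦∧not⟧ true false = refl
⟦∧⟧+⟦∧not⟧ false b = refl

-- o e / suc u is the weight of e in the fractional selection, which by average has the same total in
-- every key class as the selection by chosen.
module Redistribute {E : Set} {N k : ℕ} (es : List E) (key : E → Fin N) (chosen : E → Bool) (o : E → ℕ) (r u : ℕ)
  (average : (H : Fin N → ℕ) → suc u * ∑ es (λ e → ⟦ chosen e ⟧ * H (key e)) ≡ ∑ es (λ e → o e * H (key e)))
  (o≤ : (e : E) → o e ≤ suc u) where

  module _ (L : List (E × Fin k)) (L↭ : map proj₁ L ↭ es) (deg : (j : Fin k) → ∑ L (λ { (e , c) → o e * ⟦ c == j ⟧ }) ≡ r * suc u) where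

    -- The second component is how a permutation of colors inside classes is expressed: any
    -- statistic that sees a triple only through its `key` keeps its total. The third says that each
    -- color now occurs `r` times among the chosen triples.
    Redistribution : Set
    Redistribution = Σ[ L′ ∈ List (E × Fin k) ] (map proj₁ L′ ≡ es)
      × ((F : E × Fin k → ℕ) → (∀ e e′ c → key e ≡ key e′ → F (e , c) ≡ F (e′ , c)) → ∑ L′ F ≡ ∑ L F)
      × (∀ j → ∑ L′ (λ { (e , c) → ⟦ chosen e ⟧ * ⟦ c == j ⟧ }) ≡ r)

    private
      -- The network is bipartite: the first `N` nodes are the classes, the last `k` the colors, and
      -- each colored triple is an arc from its class to its color. In `s` a class supplies one unit
      -- for each chosen triple in it; in `t` each color demands `r`.
      tail head : E × Fin k → Fin (N + k)
      tail (e , c) = key e ↑ˡ k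
      head (e , c) = N ↑ʳ c

      open IntegralFlow tail head

      s t : List (Fin (N + k))
      s = map (λ e → key e ↑ˡ k) (filterᵇ chosen es)
      t = concatMap (λ j → replicate r (N ↑ʳ j)) (allFin k)

      weight-s : ∀ R → weight s R ≡ ∑ es (λ e → ⟦ chosen e ⟧ * ⟦ R (key e ↑ˡ k) ⟧)
      weight-s R = trans (∑-map (filterᵇ chosen es) _ (λ v → ⟦ R v ⟧)) (∑-filter chosen es _)

      weight-t : ∀ R → weight t R ≡ ∑ (allFin k) (λ j → r * ⟦ R (N ↑ʳ j) ⟧)
      weight-t R = trans (∑-concatMap (allFin k) _ (λ v → ⟦ R v ⟧)) (∑-cong (allFin k) λ j → ∑-replicate r (N ↑ʳ j) _)

      ∑-L : (f : E → ℕ) → ∑ L (f ∘ proj₁) ≡ ∑ es f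
      ∑-L f = trans (sym (∑-map L proj₁ f)) (∑-↭ f L↭)

      -- The color side of the fractional flow, scaled by `suc u`: each color receives exactly `r`.
      -- The class side is `suc-u*weight-s`, and comparing both on the set of all nodes shows that
      -- total supply equals total demand.
      ∑-L-outside : (g : Fin k → ℕ) → ∑ L (λ { (e , c) → o e * g c }) ≡ suc u * ∑ (allFin k) (λ j → r * g j)
      ∑-L-outside g = begin
        ∑ L (λ { (e , c) → o e * g c })
          ≡⟨ ∑-cong L (λ { (e , c) → trans (cong (o e *_) (sym (∑-allFin-pick c g)))
               (trans (sym (∑-*ˡ (allFin k) (o e) _)) (∑-cong (allFin k) λ j → sym (*-assoc (o e) _ (g j)))) }) ⟩
        ∑ L (λ { (e , c) → ∑ (allFin k) (λ j → o e * ⟦ c == j ⟧ * g j) })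
          ≡⟨ ∑-swap L (allFin k) (λ { (e , c) j → o e * ⟦ c == j ⟧ * g j }) ⟩
        ∑ (allFin k) (λ j → ∑ L (λ { (e , c) → o e * ⟦ c == j ⟧ * g j }))
          ≡⟨ ∑-cong (allFin k) (λ j → trans (∑-*ʳ L (g j) (λ { (e , c) → o e * ⟦ c == j ⟧ }))
               (trans (cong (_* g j) (deg j)) (lemma r (suc u) (g j)))) ⟩
        ∑ (allFin k) (λ j → suc u * (r * g j))
          ≡⟨ ∑-*ˡ (allFin k) (suc u) _ ⟩
        suc u * ∑ (allFin k) (λ j → r * g j) ∎
        where
        open ≡-Reasoning
        lemma : ∀ a b c → a * b * c ≡ b * (a * c)
        lemma = solve-∀

      suc-u*weight-s : ∀ R → suc u * weight s R ≡ ∑ L (λ { (e , c) → o e * ⟦ R (key e ↑ˡ k) ⟧ })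
      suc-u*weight-s R = trans (cong (suc u *_) (weight-s R))
        (trans (average (λ K → ⟦ R (K ↑ˡ k) ⟧)) (sym (∑-L _)))

      length-t≤length-s : length t ≤ length s
      length-t≤length-s = ≤-reflexive (trans (length≡∑ t) (trans (*-cancelˡ-≡ _ _ (suc u)
        (trans (cong (suc u *_) (weight-t (λ _ → true))) (trans (sym (∑-L-outside (λ _ → 1))) (sym (suc-u*weight-s (λ _ → true))))))
        (sym (length≡∑ s))))

      -- An arc carries the fraction `o / U` of a unit. What it takes from a tail inside the set
      -- arrives at a head inside, or it crosses the cut and is at most the capacity 1.
      cut-pointwise : ∀ {o U} b b′ → o ≤ U → o * ⟦ b ⟧ ≤ o * ⟦ b′ ⟧ + U * ⟦ b ∧ not b′ ⟧
      cut-pointwise {o} {U} true true o≤U = m≤m+n _ _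
      cut-pointwise {o} {U} true false o≤U = ≤-trans (*-monoˡ-≤ 1 o≤U) (m≤n+m _ (o * 0))
      cut-pointwise {o} {U} false b′ o≤U rewrite *-zeroʳ o = z≤n

      -- The fractional selection is a fractional flow, hence the cut condition.
      cutCondition : CutCondition L s t
      cutCondition R = *-cancelˡ-≤ (suc u) (begin
        suc u * weight s R
          ≡⟨ suc-u*weight-s R ⟩
        ∑ L (λ { (e , c) → o e * ⟦ R (key e ↑ˡ k) ⟧ })
          ≤⟨ ∑-mono L (λ { (e , c) → cut-pointwise (R (key e ↑ˡ k)) (R (N ↑ʳ c)) (o≤ e) }) ⟩
        ∑ L (λ x → o (proj₁ x) * ⟦ R (head x) ⟧ + suc u * ⟦ R (tail x) ∧ not (R (head x)) ⟧)
          ≡⟨ ∑-+ L _ _ ⟩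
        ∑ L (λ x → o (proj₁ x) * ⟦ R (head x) ⟧) + ∑ L (λ x → suc u * ⟦ R (tail x) ∧ not (R (head x)) ⟧)
          ≡⟨ cong₂ _+_ (trans (∑-L-outside (λ c → ⟦ R (N ↑ʳ c) ⟧)) (cong (suc u *_) (sym (weight-t R)))) (∑-*ˡ L (suc u) _) ⟩
        suc u * weight t R + suc u * cut L R
          ≡⟨ *-distribˡ-+ (suc u) (weight t R) (cut L R) ⟨
        suc u * (weight t R + cut L R) ∎)
        where open ≤-Reasoning

    module _ (selection : Flow L s t) where

        zs : List ((E × Fin k) × Bool)
        zs = proj₁ selection

        -- No arc enters a class node and nothing is demanded there, so flow balance equates its
        -- outflow with its supply.
        selected-at-key : ∀ K → ∑ zs (λ { ((e , _) , χ) → ⟦ (key e == K) ∧ χ ⟧ }) ≡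
                                ∑ es (λ e → ⟦ (key e == K) ∧ (chosen e) ⟧)
        selected-at-key K = begin
          ∑ zs (λ { ((e , _) , χ) → ⟦ (key e == K) ∧ χ ⟧ })
            ≡⟨ ∑-cong zs (λ { ((e , _) , χ) → cong (λ b → ⟦ b ∧ χ ⟧) (sym (↑ˡ-== (key e) K)) }) ⟩
          outflow zs (K ↑ˡ k)
            ≡⟨ cong (_+ outflow zs (K ↑ˡ k)) (trans (weight-t (_== (K ↑ˡ k))) (∑-≡0 (allFin k) λ j →
                 trans (cong (λ b → r * ⟦ b ⟧) (↑ʳ-==-↑ˡ j K)) (*-zeroʳ r))) ⟨
          weight t (_== (K ↑ˡ k)) + outflow zs (K ↑ˡ k)
            ≡⟨ proj₂ (proj₂ selection) (K ↑ˡ k) ⟨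
          weight s (_== (K ↑ˡ k)) + inflow zs (K ↑ˡ k)
            ≡⟨ cong₂ _+_ (weight-s (_== (K ↑ˡ k))) (∑-≡0 zs λ { ((_ , c) , χ) → cong (λ b → ⟦ b ∧ χ ⟧) (↑ʳ-==-↑ˡ c K) }) ⟩
          ∑ es (λ e → ⟦ chosen e ⟧ * ⟦ (key e ↑ˡ k) == (K ↑ˡ k) ⟧) + 0
            ≡⟨ trans (+-identityʳ _) (∑-cong es λ e → trans (cong (λ b → ⟦ chosen e ⟧ * ⟦ b ⟧) (↑ˡ-== (key e) K))
                 (trans (*-comm ⟦ chosen e ⟧ _) (sym (⟦∧⟧ (key e == K) (chosen e))))) ⟩
          ∑ es (λ e → ⟦ (key e == K) ∧ (chosen e) ⟧) ∎
          where open ≡-Reasoning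

        -- No arc leaves a color node and nothing is supplied there, so its inflow is its demand.
        selected-of-color : ∀ j → ∑ zs (λ { ((_ , c) , χ) → ⟦ (c == j) ∧ χ ⟧ }) ≡ r
        selected-of-color j = begin
          ∑ zs (λ { ((_ , c) , χ) → ⟦ (c == j) ∧ χ ⟧ })
            ≡⟨ ∑-cong zs (λ { ((_ , c) , χ) → cong (λ b → ⟦ b ∧ χ ⟧) (sym (↑ʳ-== {N} c j)) }) ⟩
          inflow zs (N ↑ʳ j)
            ≡⟨ cong (_+ inflow zs (N ↑ʳ j)) (trans (weight-s (_== (N ↑ʳ j))) (∑-≡0 es λ e →
                 trans (cong (λ b → ⟦ chosen e ⟧ * ⟦ b ⟧) (↑ˡ-==-↑ʳ (key e) j)) (*-zeroʳ ⟦ chosen e ⟧))) ⟨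
          weight s (_== (N ↑ʳ j)) + inflow zs (N ↑ʳ j)
            ≡⟨ proj₂ (proj₂ selection) (N ↑ʳ j) ⟩
          weight t (_== (N ↑ʳ j)) + outflow zs (N ↑ʳ j)
            ≡⟨ cong₂ _+_ (trans (weight-t (_== (N ↑ʳ j))) (∑-cong (allFin k) λ i →
                  trans (cong (λ b → r * ⟦ b ⟧) (trans (↑ʳ-== {N} i j) (==-sym i j))) (*-comm r _)))
                 (∑-≡0 zs λ { ((e , _) , χ) → cong (λ b → ⟦ b ∧ χ ⟧) (↑ˡ-==-↑ʳ (key e) j) }) ⟩
          ∑ (allFin k) (λ i → ⟦ j == i ⟧ * r) + 0
            ≡⟨ trans (+-identityʳ _) (∑-allFin-pick j (λ _ → r)) ⟩
          r ∎
          where open ≡-Reasoning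

        ∑-zs : (f : E × Fin k → ℕ) → ∑ zs (f ∘ proj₁) ≡ ∑ L f
        ∑-zs f = trans (sym (∑-map zs proj₁ f)) (cong (λ xs → ∑ xs f) (proj₁ (proj₂ selection)))

        at-key : ∀ K → ∑ zs (λ { ((e , _) , _) → ⟦ key e == K ⟧ }) ≡ ∑ es (λ e → ⟦ key e == K ⟧)
        at-key K = trans (∑-zs (λ { (e , _) → ⟦ key e == K ⟧ })) (∑-L (λ e → ⟦ key e == K ⟧))

        -- The flow selects colored triples that need not be the chosen ones. A bijection that
        -- respects the class and turns "selected" into "chosen" hands the selected colors to the
        -- chosen triples; refining the key by a Boolean makes it a matching of equal labels.
        oldClass : (E × Fin k) × Bool → Fin N × Bool
        oldClass ((e , _) , χ) = key e , χ

        newClass : E → Fin N × Bool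
        newClass e = key e , (chosen e)

        _≟ᶜ_ : (x y : Fin N × Bool) → Dec (x ≡ y)
        _≟ᶜ_ = ×-≡-dec Fin._≟_ Bool._≟_

        false≢true : false ≢ true
        false≢true ()

        ≟ᶜ-true : ∀ K b K′ → ⌊ (K , b) ≟ᶜ (K′ , true) ⌋ ≡ (K == K′) ∧ b
        ≟ᶜ-true K b K′ with K == K′ in eq | b
        ... | true | true = isYes-true (_ ≟ᶜ _) (cong (_, true) (==⇒≡ eq))
        ... | true | false = isYes-false (_ ≟ᶜ _) λ ()
        ... | false | b = isYes-false (_ ≟ᶜ _) λ { refl → false≢true (trans (sym eq) (==-refl K)) }

        ≟ᶜ-false : ∀ K b K′ → ⌊ (K , b) ≟ᶜ (K′ , false) ⌋ ≡ (K == K′) ∧ not b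
        ≟ᶜ-false K b K′ with K == K′ in eq | b
        ... | true | false = isYes-true (_ ≟ᶜ _) (cong (_, false) (==⇒≡ eq))
        ... | true | true = isYes-false (_ ≟ᶜ _) λ ()
        ... | false | b = isYes-false (_ ≟ᶜ _) λ { refl → false≢true (trans (sym eq) (==-refl K)) }

        -- For the label `true` the multiplicities agree by flow balance at the class; for `false`
        -- they agree by subtraction, since the class has the same size in both lists.
        classes↭ : map oldClass zs ↭ map newClass es
        classes↭ = sameMultiplicity⇒↭ _≟ᶜ_ _ _ λ
          { (K , true) → trans (∑-map zs oldClass _) (trans (∑-cong zs λ { ((e , _) , χ) → cong ⟦_⟧ (≟ᶜ-true (key e) χ K) })
              (trans (selected-at-key K) (sym (trans (∑-map es newClass _)
                (∑-cong es λ e → cong ⟦_⟧ (≟ᶜ-true (key e) (chosen e) K))))))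
          ; (K , false) → trans (∑-map zs oldClass _) (trans (∑-cong zs λ { ((e , _) , χ) → cong ⟦_⟧ (≟ᶜ-false (key e) χ K) })
              (trans (unselected-at-key K) (sym (trans (∑-map es newClass _)
                (∑-cong es λ e → cong ⟦_⟧ (≟ᶜ-false (key e) (chosen e) K)))))) }
          where
          unselected-at-key : ∀ K → ∑ zs (λ { ((e , _) , χ) → ⟦ (key e == K) ∧ not χ ⟧ }) ≡
                                    ∑ es (λ e → ⟦ (key e == K) ∧ not (chosen e) ⟧)
          unselected-at-key K = +-cancelˡ-≡ (∑ zs (λ { ((e , _) , χ) → ⟦ (key e == K) ∧ χ ⟧ })) _ _
            (trans (sym (∑-+ zs _ _)) (trans (∑-cong zs λ { ((e , _) , χ) → ⟦∧⟧+⟦∧not⟧ (key e == K) χ })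
              (trans (at-key K) (trans (∑-cong es λ e → sym (⟦∧⟧+⟦∧not⟧ (key e == K) (chosen e)))
                (trans (∑-+ es _ _) (cong (_+ ∑ es (λ e → ⟦ (key e == K) ∧ not (chosen e) ⟧)) (sym (selected-at-key K))))))))

        module _ (ps : List (Σ[ p ∈ E × ((E × Fin k) × Bool) ] newClass (proj₁ p) ≡ oldClass (proj₂ p)))
                 (fst≡ : map (proj₁ ∘ proj₁) ps ≡ es) (snd↭ : map (proj₂ ∘ proj₁) ps ↭ zs) where

          recolor : (Σ[ p ∈ E × ((E × Fin k) × Bool) ] newClass (proj₁ p) ≡ oldClass (proj₂ p)) → E × Fin k
          recolor ((e , ((_ , c) , _)) , _) = e , c

          ∑-ps : (f : (E × Fin k) × Bool → ℕ) → ∑ ps (λ p → f (proj₂ (proj₁ p))) ≡ ∑ zs f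
          ∑-ps f = trans (sym (∑-map ps (proj₂ ∘ proj₁) f)) (∑-↭ f snd↭)

          preserved : (F : E × Fin k → ℕ) → (∀ e e′ c → key e ≡ key e′ → F (e , c) ≡ F (e′ , c)) →
                      ∑ (map recolor ps) F ≡ ∑ L F
          preserved F resp = trans (∑-map ps recolor F)
            (trans (∑-cong ps λ { ((e , ((e′ , c) , χ)) , same) → resp e e′ c (cong proj₁ same) })
              (trans (∑-ps (F ∘ proj₁)) (∑-zs F)))

          degree : ∀ j → ∑ (map recolor ps) (λ { (e , c) → ⟦ chosen e ⟧ * ⟦ c == j ⟧ }) ≡ r
          degree j = trans (∑-map ps recolor _)
            (trans (∑-cong ps λ { ((e , ((e′ , c) , χ)) , same) →
                trans (cong (λ b → ⟦ b ⟧ * ⟦ c == j ⟧) (cong proj₂ same)) (trans (*-comm ⟦ χ ⟧ _) (sym (⟦∧⟧ (c == j) χ))) })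
              (trans (∑-ps (λ { ((_ , c) , χ) → ⟦ (c == j) ∧ χ ⟧ })) (selected-of-color j)))

          fromAligned : Redistribution
          fromAligned = map recolor ps , trans (sym (map-∘ ps)) fst≡ , preserved , degree

        -- The permutation of labels is lifted to a rearrangement of the flagged arcs; position by
        -- position, each triple then faces a colored triple of its own class whose color it takes
        -- over.
        fromSelection : Redistribution
        fromSelection = fromInverse (↭-map-inv oldClass classes↭)
          where
          fromInverse : Σ[ zs′ ∈ List ((E × Fin k) × Bool) ] (map newClass es ≡ map oldClass zs′ × zs ↭ zs′) → Redistribution
          fromInverse (zs′ , eq , zs↭zs′) = fromAlign (align newClass oldClass es zs′ eq)
            where
            fromAlign : Σ[ ps ∈ List (Σ[ p ∈ E × ((E × Fin k) × Bool) ] newClass (proj₁ p) ≡ oldClass (proj₂ p)) ]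
              (map (proj₁ ∘ proj₁) ps ≡ es) × (map (proj₂ ∘ proj₁) ps ≡ zs′) → Redistribution
            fromAlign (ps , fst≡ , snd≡) = fromAligned ps fst≡ (subst (_↭ zs) (sym snd≡) (↭-sym zs↭zs′))

    redistribute : Redistribution
    redistribute = fromSelection (flow L s t length-t≤length-s cutCondition)

-- Singling out one pair or triple, and colorings given as lists

_≟₃_ : DecidableEquality (Triple n)
triple a b c p q ≟₃ triple a′ b′ c′ p′ q′ with a Fin.≟ a′ | b Fin.≟ b′ | c Fin.≟ c′
... | yes refl | yes refl | yes refl = yes (triple-≡ refl refl refl)
... | no a≢ | _ | _ = no λ { refl → a≢ refl }
... | _ | no b≢ | _ = no λ { refl → b≢ refl }
... | _ | _ | no c≢ = no λ { refl → c≢ refl }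

_≟₂_ : DecidableEquality (Pair n)
pair a b p ≟₂ pair a′ b′ p′ with a Fin.≟ a′ | b Fin.≟ b′
... | yes refl | yes refl = yes (pair-≡ refl refl)
... | no a≢ | _ = no λ { refl → a≢ refl }
... | _ | no b≢ = no λ { refl → b≢ refl }

when-0 : {P : Set} (d : Dec P) {f : P → ℕ} → (∀ p → f p ≡ 0) → when d f ≡ 0
when-0 (yes p) eq = eq p
when-0 (no _) _ = refl

==-false-* : {i j : Fin n} (c : ℕ) → i ≢ j → ⟦ i == j ⟧ * c ≡ 0
==-false-* c i≢j = cong (λ b → ⟦ b ⟧ * c) (==-≢ i≢j)

==-true-* : (i : Fin n) (c : ℕ) → ⟦ i == i ⟧ * c ≡ c
==-true-* i c = trans (cong (λ b → ⟦ b ⟧ * c) (==-refl i)) (+-identityʳ c)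

∑-allPairs-pick : (S : Pair n) (g : Pair n → ℕ) → ∑ (allPairs n) (λ S′ → ⟦ ⌊ S′ ≟₂ S ⌋ ⟧ * g S′) ≡ g S
∑-allPairs-pick {n} S@(pair a b a<b) g = begin
  ∑ (allPairs n) (λ S′ → ⟦ ⌊ S′ ≟₂ S ⌋ ⟧ * g S′) ≡⟨ ∑-allPairs {n} (λ S′ → ⟦ ⌊ S′ ≟₂ S ⌋ ⟧ * g S′) ⟩
  ∑ (allFin n) (λ x → ∑ (allFin n) λ y → G x y)  ≡⟨ (∑-cong (allFin n) λ x → ∑-cong (allFin n) λ y → pointwise x y) ⟩
  ∑ (allFin n) (λ x → ∑ (allFin n) λ y → ⟦ a == x ⟧ * (⟦ b == y ⟧ * g S))
    ≡⟨ (∑-cong (allFin n) λ x → ∑-*ˡ (allFin n) ⟦ a == x ⟧ _) ⟩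
  ∑ (allFin n) (λ x → ⟦ a == x ⟧ * ∑ (allFin n) λ y → (⟦ b == y ⟧ * g S)) ≡⟨ ∑-allFin-pick a _ ⟩
  ∑ (allFin n) (λ y → ⟦ b == y ⟧ * g S) ≡⟨ ∑-allFin-pick b _ ⟩
  g S ∎
  where
  open ≡-Reasoning
  G : Fin n → Fin n → ℕ
  G x y = when (x <?ᶠ y) λ p → ⟦ ⌊ pair x y p ≟₂ S ⌋ ⟧ * g (pair x y p)
  off : ∀ {x y p} → pair x y p ≢ S → ⟦ ⌊ pair x y p ≟₂ S ⌋ ⟧ * g (pair x y p) ≡ 0
  off {x} {y} {p} ≢S = cong (λ b → ⟦ b ⟧ * g (pair x y p)) (isYes-false (pair x y p ≟₂ S) ≢S)
  pointwise : ∀ x y → G x y ≡ ⟦ a == x ⟧ * (⟦ b == y ⟧ * g S)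
  pointwise x y with a Fin.≟ x | b Fin.≟ y
  ... | no a≢x | _ = when-0 (x <?ᶠ y) λ p → off {x} {y} {p} λ { refl → a≢x refl }
  ... | yes _ | no b≢y = when-0 (x <?ᶠ y) λ p → off {x} {y} {p} λ { refl → b≢y refl }
  ... | yes refl | yes refl = trans (when-yes (a <?ᶠ b) a<b λ p →
    cong₂ (λ t i → ⟦ t ⟧ * i) (isYes-true (pair a b p ≟₂ S) (pair-≡ refl refl)) (cong g (pair-≡ refl refl)))
    (sym (+-identityʳ _))

∑-allTriples-pick : (S : Triple n) (g : Triple n → ℕ) → ∑ (allTriples n) (λ S′ → ⟦ ⌊ S′ ≟₃ S ⌋ ⟧ * g S′) ≡ g S
∑-allTriples-pick {n} S@(triple a b c a<b b<c) g = begin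
  ∑ (allTriples n) (λ S′ → ⟦ ⌊ S′ ≟₃ S ⌋ ⟧ * g S′) ≡⟨ ∑-allTriples {n} (λ S′ → ⟦ ⌊ S′ ≟₃ S ⌋ ⟧ * g S′) ⟩
  ∑ (allFin n) (λ x → ∑ (allFin n) λ y → ∑ (allFin n) λ z → G x y z)
    ≡⟨ (∑-cong (allFin n) λ x → trans (∑-cong (allFin n) λ y → trans (∑-cong (allFin n) λ z → pointwise x y z)
         (∑-*ˡ (allFin n) ⟦ a == x ⟧ _)) (∑-*ˡ (allFin n) ⟦ a == x ⟧ _)) ⟩
  ∑ (allFin n) (λ x → ⟦ a == x ⟧ * ∑ (allFin n) λ y → ∑ (allFin n) λ z → ⟦ b == y ⟧ * (⟦ c == z ⟧ * g S))
    ≡⟨ ∑-allFin-pick a _ ⟩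
  ∑ (allFin n) (λ y → ∑ (allFin n) λ z → ⟦ b == y ⟧ * (⟦ c == z ⟧ * g S))
    ≡⟨ (∑-cong (allFin n) λ y → ∑-*ˡ (allFin n) ⟦ b == y ⟧ _) ⟩
  ∑ (allFin n) (λ y → ⟦ b == y ⟧ * ∑ (allFin n) λ z → (⟦ c == z ⟧ * g S)) ≡⟨ ∑-allFin-pick b _ ⟩
  ∑ (allFin n) (λ z → ⟦ c == z ⟧ * g S) ≡⟨ ∑-allFin-pick c _ ⟩
  g S ∎
  where
  open ≡-Reasoning
  G : Fin n → Fin n → Fin n → ℕ
  G x y z = when (x <?ᶠ y) λ p → when (y <?ᶠ z) λ q → ⟦ ⌊ triple x y z p q ≟₃ S ⌋ ⟧ * g (triple x y z p q)
  off : ∀ {x y z p q} → triple x y z p q ≢ S → ⟦ ⌊ triple x y z p q ≟₃ S ⌋ ⟧ * g (triple x y z p q) ≡ 0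
  off {x} {y} {z} {p} {q} ≢S = cong (λ b → ⟦ b ⟧ * g (triple x y z p q)) (isYes-false (triple x y z p q ≟₃ S) ≢S)
  pointwise : ∀ x y z → G x y z ≡ ⟦ a == x ⟧ * (⟦ b == y ⟧ * (⟦ c == z ⟧ * g S))
  pointwise x y z with a Fin.≟ x | b Fin.≟ y | c Fin.≟ z
  ... | no a≢x | _ | _ = when-0 (x <?ᶠ y) λ p → when-0 (y <?ᶠ z) λ q → off {x} {y} {z} {p} {q} λ { refl → a≢x refl }
  ... | yes _ | no b≢y | _ = when-0 (x <?ᶠ y) λ p → when-0 (y <?ᶠ z) λ q → off {x} {y} {z} {p} {q} λ { refl → b≢y refl }
  ... | yes _ | yes _ | no c≢z = when-0 (x <?ᶠ y) λ p → when-0 (y <?ᶠ z) λ q → off {x} {y} {z} {p} {q} λ { refl → c≢z refl }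
  ... | yes refl | yes refl | yes refl = trans (when-yes (a <?ᶠ b) a<b λ p → when-yes (b <?ᶠ c) b<c λ q →
    cong₂ (λ t i → ⟦ t ⟧ * i) (isYes-true (triple a b c p q ≟₃ S) (triple-≡ refl refl refl)) (cong g (triple-≡ refl refl refl)))
    (sym (trans (+-identityʳ _) (+-identityʳ _)))

multiplicity-allTriples : (S : Triple n) → ∑ (allTriples n) (λ S′ → ⟦ ⌊ S′ ≟₃ S ⌋ ⟧) ≡ 1
multiplicity-allTriples {n} S = trans (∑-cong (allTriples n) λ S′ → sym (*-identityʳ _)) (∑-allTriples-pick S (λ _ → 1))

module _ {A B : Set} (_≟_ : DecidableEquality A) (default : B) where

  lookupColor : List (A × B) → A → B
  lookupColor [] x = default
  lookupColor ((a , b) ∷ L) x = if ⌊ x ≟ a ⌋ then b else lookupColor L x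

  private
    ∑-skip : (a : A) (b : B) (f : A → B) (F : A × B → ℕ) (xs : List A) → ∑ xs (λ x → ⟦ ⌊ x ≟ a ⌋ ⟧) ≡ 0 →
             ∑ xs (λ x → F (x , (if ⌊ x ≟ a ⌋ then b else f x))) ≡ ∑ xs (λ x → F (x , f x))
    ∑-skip a b f F [] eq = refl
    ∑-skip a b f F (x ∷ xs) eq with x ≟ a
    ... | no _ = cong (F (x , f x) +_) (∑-skip a b f F xs eq)

  -- The first match for a triple could hide later entries. If every triple occurs at most once
  -- there are none, so lookup returns each entry's own color.
  ∑-lookupColor : (L : List (A × B)) → (∀ a → ∑ (map proj₁ L) (λ x → ⟦ ⌊ x ≟ a ⌋ ⟧) ≤ 1) → (F : A × B → ℕ) →
                  ∑ (map proj₁ L) (λ x → F (x , lookupColor L x)) ≡ ∑ L F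
  ∑-lookupColor [] simple F = refl
  ∑-lookupColor ((a , b) ∷ L) simple F = cong₂ _+_
    (cong (λ t → F (a , (if t then b else lookupColor L a))) (isYes-true (a ≟ a) refl))
    (trans (∑-skip a b (lookupColor L) F (map proj₁ L) (n≤0⇒n≡0 (s≤s⁻¹ (subst (λ t → ⟦ t ⟧ + ∑ (map proj₁ L) (λ x → ⟦ ⌊ x ≟ a ⌋ ⟧) ≤ 1) (isYes-true (a ≟ a) refl) (simple a)))))
      (∑-lookupColor L (λ x → ≤-trans (m≤n+m _ ⟦ ⌊ a ≟ x ⌋ ⟧) (simple x)) F))

-- What the class of a triple determines

trace : ℕ → Triple n → List (Fin n)
trace m e = filterᵇ (λ v → toℕ v <ᵇ m) (elems3 e)

amalgamate-≡ : ∀ {w x y : Fin n} → amalgamate w x ≡ amalgamate w y → (x ≡ y) ⊎ (toℕ w ≤ toℕ x × toℕ w ≤ toℕ y)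
amalgamate-≡ {w = w} {x} {y} eq with toℕ x <? toℕ w | toℕ y <? toℕ w
... | no p | no q = inj₂ (≮⇒≥ p , ≮⇒≥ q)
... | yes p | yes q = inj₁ (trans (sym (amalgamate-< p)) (trans eq (amalgamate-< q)))
... | yes p | no q = ⊥-elim (<⇒≢ p (cong toℕ (trans (sym (amalgamate-< p)) (trans eq (amalgamate-≥ (≮⇒≥ q))))))
... | no p | yes q = ⊥-elim (<⇒≢ q (cong toℕ (trans (sym (amalgamate-< q)) (trans (sym eq) (amalgamate-≥ (≮⇒≥ p))))))

key-injective : ∀ {w : Fin n} (e e′ : Triple n) → key w e ≡ key w e′ →
  (amalgamate w (Triple.a e) ≡ amalgamate w (Triple.a e′)) ×
  (amalgamate w (Triple.b e) ≡ amalgamate w (Triple.b e′)) ×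
  (amalgamate w (Triple.c e) ≡ amalgamate w (Triple.c e′))
key-injective {w = w} e e′ eq with combine-injective (amalgamate w (Triple.a e)) _ (amalgamate w (Triple.a e′)) _ eq
... | a≡ , bc≡ = a≡ , combine-injective _ _ _ _ bc≡

-- Coordinates with the same amalgamation are equal or both from `w` on. In the second case both lie
-- beyond the first `m` vertices, and the trace drops them.
key⇒trace : ∀ {m} {w : Fin n} (e e′ : Triple n) → m ≤ toℕ w → key w e ≡ key w e′ → trace m e ≡ trace m e′
key⇒trace {n} {m} {w} e@(triple a b c _ _) e′@(triple a′ b′ c′ _ _) m≤w eq with key-injective {w = w} e e′ eq
... | a≡ , b≡ , c≡ =
  cons {xs = b ∷ c ∷ []} {b′ ∷ c′ ∷ []} a≡ (cons {xs = c ∷ []} {c′ ∷ []} b≡ (cons {xs = []} {[]} c≡ refl))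
  where
  keep : List (Fin n) → List (Fin n)
  keep = filterᵇ (λ v → toℕ v <ᵇ m)
  skip : ∀ {x xs} → toℕ w ≤ toℕ x → keep (x ∷ xs) ≡ keep xs
  skip w≤x rewrite <ᵇ-false (≤-trans m≤w w≤x) = refl
  same : ∀ {x xs ys} → keep xs ≡ keep ys → keep (x ∷ xs) ≡ keep (x ∷ ys)
  same {x} eq with toℕ x <ᵇ m
  ... | true = cong (x ∷_) eq
  ... | false = eq
  cons : ∀ {x y xs ys} → amalgamate w x ≡ amalgamate w y → keep xs ≡ keep ys → keep (x ∷ xs) ≡ keep (y ∷ ys)
  cons {x} {y} {xs} {ys} x~y eq with amalgamate-≡ {w = w} {x} {y} x~y
  ... | inj₁ refl = same {x} {xs} {ys} eq
  ... | inj₂ (w≤x , w≤y) = trans (skip {x} {xs} w≤x) (trans eq (sym (skip {y} {ys} w≤y)))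

key⇒∈3 : ∀ {v w : Fin n} (e e′ : Triple n) → suc (toℕ v) ≤ toℕ w → key w e ≡ key w e′ → (v ∈3 e) ≡ (v ∈3 e′)
key⇒∈3 {n} {v} {w} e@(triple _ _ _ _ _) e′@(triple _ _ _ _ _) v<w eq with key-injective {w = w} e e′ eq
... | a≡ , b≡ , c≡ = cong₂ _∨_ (same a≡) (cong₂ _∨_ (same b≡) (same c≡))
  where
  off : ∀ {x} → toℕ w ≤ toℕ x → (v == x) ≡ false
  off w≤x = ==-≢ λ { refl → <⇒≱ v<w w≤x }
  same : ∀ {x y} → amalgamate w x ≡ amalgamate w y → (v == x) ≡ (v == y)
  same {x} {y} x~y with amalgamate-≡ {w = w} {x} {y} x~y
  ... | inj₁ refl = refl
  ... | inj₂ (w≤x , w≤y) = trans (off w≤x) (sym (off w≤y))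

-- Induction over the vertices of U

EdgeColoring : ℕ → ℕ → Set
EdgeColoring n k = List (Triple n × Fin k)

module Disentangle (n k r m : ℕ) (L₀ : EdgeColoring n k) where

  degree : EdgeColoring n k → Fin n → Fin k → ℕ
  degree L v j = ∑ L (λ { (e , c) → ⟦ v ∈3 e ⟧ * ⟦ c == j ⟧ })

  -- The invariant when the vertices before `M` are regular. `sizes` is carried along because it
  -- fixes the degree of the amalgamated vertex in each color. `traces` compares with the initial
  -- coloring `L₀` through test functions that depend on the trace and the color only.
  record SplitUpTo (M : ℕ) (L : EdgeColoring n k) : Set where
    field
      edges : map proj₁ L ↭ allTriples n
      degrees : ∀ v j → suc (toℕ v) ≤ M → degree L v j ≡ r
      sizes : ∀ j → 3 * ∑ L (λ { (_ , c) → ⟦ c == j ⟧ }) ≡ r * n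
      traces : (F : Triple n × Fin k → ℕ) → (∀ e e′ c → trace m e ≡ trace m e′ → F (e , c) ≡ F (e′ , c)) →
               ∑ L F ≡ ∑ L₀ F
  open SplitUpTo

  -- By `sizes` a color has `r * n` incidences. The `M` finished vertices take `r` each, which
  -- leaves `r` per amalgamated vertex on average.
  amalgamatedDegree : ∀ {M u} (w : Fin n) → toℕ w ≡ M → n ≡ M + u → (L : EdgeColoring n k) → SplitUpTo M L → ∀ j →
                      ∑ L (λ { (e , c) → sumOver (outside w) e * ⟦ c == j ⟧ }) ≡ r * u
  amalgamatedDegree {M} {u} w refl n≡ L inv j = +-cancelʳ-≡ (M * r) _ _ (begin
    ∑ L (λ { (e , c) → sumOver (outside w) e * ⟦ c == j ⟧ }) + M * r
      ≡⟨ cong (∑ L (λ { (e , c) → sumOver (outside w) e * ⟦ c == j ⟧ }) +_) inside≡ ⟨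
    ∑ L (λ { (e , c) → sumOver (outside w) e * ⟦ c == j ⟧ }) + ∑ L (λ { (e , c) → sumOver inside e * ⟦ c == j ⟧ })
      ≡⟨ ∑-+ L _ _ ⟨
    ∑ L (λ x → sumOver (outside w) (proj₁ x) * ⟦ proj₂ x == j ⟧ + sumOver inside (proj₁ x) * ⟦ proj₂ x == j ⟧)
      ≡⟨ ∑-cong L (λ { (e , c) → trans (sym (*-distribʳ-+ ⟦ c == j ⟧ (sumOver (outside w) e) _)) (cong (_* ⟦ c == j ⟧) (three e)) }) ⟩
    ∑ L (λ { (e , c) → 3 * ⟦ c == j ⟧ })   ≡⟨ ∑-*ˡ L 3 (λ { (_ , c) → ⟦ c == j ⟧ }) ⟩
    3 * ∑ L (λ { (_ , c) → ⟦ c == j ⟧ })   ≡⟨ sizes inv j ⟩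
    r * n                                  ≡⟨ cong (r *_) n≡ ⟩
    r * (M + u)                            ≡⟨ lemma r M u ⟩
    r * u + M * r                          ∎)
    where
    open ≡-Reasoning
    lemma : ∀ r M u → r * (M + u) ≡ r * u + M * r
    lemma = solve-∀
    inside : Fin n → ℕ
    inside v = ⟦ toℕ v <ᵇ M ⟧
    three : ∀ e → sumOver (outside w) e + sumOver inside e ≡ 3
    three (triple a b c _ _) = trans (shuffle (outside w a) (outside w b) (outside w c) (inside a) (inside b) (inside c)) (cong₂ _+_ (one a) (cong₂ _+_ (one b) (one c)))
      where
      one : ∀ x → outside w x + inside x ≡ 1
      one x with toℕ x <ᵇ M
      ... | true = refl
      ... | false = refl
      shuffle : ∀ a b c d e f → (a + (b + c)) + (d + (e + f)) ≡ (a + d) + ((b + e) + (c + f))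
      shuffle = solve-∀
    #inside : ∀ N M u → N ≡ M + u → ∑ (allFin N) (λ v → ⟦ toℕ v <ᵇ M ⟧) ≡ M
    #inside _ M u refl = trans (∑-allFin-+ M u _) (trans (cong₂ _+_
      (∑-cong (allFin M) λ v → cong ⟦_⟧ (<ᵇ-true (subst (λ i → suc i ≤ M) (sym (toℕ-↑ˡ v u)) (toℕ<n v))))
      (∑-≡0 (allFin u) λ v → cong ⟦_⟧ (<ᵇ-false (subst (M ≤_) (sym (toℕ-↑ʳ M v)) (m≤m+n M _)))))
      (trans (+-identityʳ _) (trans (∑-allFin-const M 1) (*-identityʳ M))))
    inside-degree : ∀ v → inside v * degree L v j ≡ inside v * r
    inside-degree v with toℕ v <? M
    ... | yes v<M = cong (inside v *_) (degrees inv v j v<M)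
    ... | no v≮M rewrite <ᵇ-false (≮⇒≥ v≮M) = refl
    inside≡ : ∑ L (λ { (e , c) → sumOver inside e * ⟦ c == j ⟧ }) ≡ M * r
    inside≡ = begin
      ∑ L (λ { (e , c) → sumOver inside e * ⟦ c == j ⟧ })
        ≡⟨ ∑-cong L (λ { (e , c) → trans (cong (_* ⟦ c == j ⟧) (sym (∑-∈3 inside e)))
             (trans (sym (∑-*ʳ (allFin n) ⟦ c == j ⟧ _)) (∑-cong (allFin n) λ v → *-assoc (inside v) _ _)) }) ⟩
      ∑ L (λ { (e , c) → ∑ (allFin n) (λ v → inside v * (⟦ v ∈3 e ⟧ * ⟦ c == j ⟧)) })
        ≡⟨ ∑-swap L (allFin n) (λ { (e , c) v → inside v * (⟦ v ∈3 e ⟧ * ⟦ c == j ⟧) }) ⟩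
      ∑ (allFin n) (λ v → ∑ L (λ { (e , c) → inside v * (⟦ v ∈3 e ⟧ * ⟦ c == j ⟧) }))
        ≡⟨ (∑-cong (allFin n) λ v → trans (∑-*ˡ L (inside v) (λ { (e , c) → ⟦ v ∈3 e ⟧ * ⟦ c == j ⟧ })) (inside-degree v)) ⟩
      ∑ (allFin n) (λ v → inside v * r)
        ≡⟨ ∑-*ʳ (allFin n) r inside ⟩
      ∑ (allFin n) inside * r ≡⟨ cong (_* r) (#inside n M u n≡) ⟩
      M * r ∎

  splitNext : ∀ M u → n ≡ M + suc u → m ≤ M → (L : EdgeColoring n k) → SplitUpTo M L →
              Σ[ L′ ∈ EdgeColoring n k ] SplitUpTo (suc M) L′
  splitNext M u refl m≤M L inv = fromStep (Redistribute.redistribute (allTriples n) (key w) (w ∈3_)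
    (sumOver (outside w)) r u (∑-∋w-average {M} {u}) outside≤ L (edges inv) (amalgamatedDegree w toℕ-w refl L inv))
    where
    w : Fin n
    w = M ↑ʳ zero
    toℕ-w : toℕ w ≡ M
    toℕ-w = trans (toℕ-↑ʳ M zero) (+-identityʳ M)
    outside≤ : ∀ e → sumOver (outside w) e ≤ suc u
    outside≤ e = +-cancelʳ-≤ M _ _ (≤-trans (subst (λ i → sumOver (outside w) e + i ≤ n) toℕ-w (sumOver-outside-≤ w e))
      (≤-reflexive (+-comm M (suc u))))
    fromStep : Σ[ L′ ∈ EdgeColoring n k ] (map proj₁ L′ ≡ allTriples n)
      × ((F : Triple n × Fin k → ℕ) → (∀ e e′ c → key w e ≡ key w e′ → F (e , c) ≡ F (e′ , c)) → ∑ L′ F ≡ ∑ L F)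
      × (∀ j → ∑ L′ (λ { (e , c) → ⟦ w ∈3 e ⟧ * ⟦ c == j ⟧ }) ≡ r) →
      Σ[ L′ ∈ EdgeColoring n k ] SplitUpTo (suc M) L′
    fromStep (L′ , edges′ , preserved , degree-w) = L′ , record
      { edges = ↭-reflexive edges′
      ; degrees = degrees′
      ; sizes = λ j → trans (cong (3 *_) (preserved _ λ _ _ _ _ → refl)) (sizes inv j)
      ; traces = λ F resp → trans (preserved F λ e e′ c eq →
          resp e e′ c (key⇒trace e e′ (≤-trans m≤M (≤-reflexive (sym toℕ-w))) eq)) (traces inv F resp)
      }
      where
      degrees′ : ∀ v j → suc (toℕ v) ≤ suc M → degree L′ v j ≡ r
      -- Incidence with a vertex before `w` is a function of the class, hence unchanged; at `w`
      -- itself the flow provides degree `r`.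
      degrees′ v j (s≤s v≤M) with m≤n⇒m<n∨m≡n v≤M
      ... | inj₁ v<M = trans (preserved _ λ e e′ c eq → cong (λ b → ⟦ b ⟧ * ⟦ c == j ⟧)
        (key⇒∈3 e e′ (≤-trans v<M (≤-reflexive (sym toℕ-w))) eq)) (degrees inv v j v<M)
      ... | inj₂ v≡M with toℕ-injective {i = v} {w} (trans v≡M (sym toℕ-w))
      ... | refl = degree-w j

  splitAll : ∀ u M → n ≡ M + u → m ≤ M → (L : EdgeColoring n k) → SplitUpTo M L →
             Σ[ L′ ∈ EdgeColoring n k ] SplitUpTo n L′
  splitAll zero M n≡ m≤M L inv = L , subst (λ M → SplitUpTo M L) (sym (trans n≡ (+-identityʳ M))) inv
  splitAll (suc u) M n≡ m≤M L inv with splitNext M u n≡ m≤M L inv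
  ... | L′ , inv′ = splitAll u (suc M) (trans n≡ (+-suc M u)) (m≤n⇒m≤1+n m≤M) L′ inv′

-- Colors by trace on V

-- Used in two roles: as a weight that depends only on `e ∩ V`, and as the number of hyperedges of
-- one color with a given trace. `pairing` of a weight with such numbers is the weighted count of
-- that color, so degrees, sizes and trace counts of F and of a coloring of `K_n^3` become pairings
-- that can be compared.
record TraceFunction (m : ℕ) : Set where
  constructor byTrace
  field
    at₃ : Triple m → ℕ
    at₂ : Pair m → ℕ
    at₁ : Fin m → ℕ
    at₀ : ℕ
open TraceFunction

pairing : ∀ {m} → TraceFunction m → TraceFunction m → ℕ
pairing {m} h X = (∑ (allTriples m) (λ S → at₃ h S * at₃ X S) + ∑ (allPairs m) (λ S → at₂ h S * at₂ X S))
                  + (∑ (allFin m) (λ v → at₁ h v * at₁ X v) + at₀ h * at₀ X)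

pairing-congʳ : ∀ {m} (h : TraceFunction m) {X Y : TraceFunction m} → (∀ S → at₃ X S ≡ at₃ Y S) →
  (∀ S → at₂ X S ≡ at₂ Y S) → (∀ v → at₁ X v ≡ at₁ Y v) → at₀ X ≡ at₀ Y → pairing h X ≡ pairing h Y
pairing-congʳ {m} h eq₃ eq₂ eq₁ eq₀ = cong₂ _+_
  (cong₂ _+_ (∑-cong (allTriples m) λ S → cong (at₃ h S *_) (eq₃ S)) (∑-cong (allPairs m) λ S → cong (at₂ h S *_) (eq₂ S)))
  (cong₂ _+_ (∑-cong (allFin m) λ v → cong (at₁ h v *_) (eq₁ v)) (cong (at₀ h *_) eq₀))

ones : ∀ {m} → TraceFunction m
ones = byTrace (λ _ → 1) (λ _ → 1) (λ _ → 1) 1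

incidence : ∀ {m} → Fin m → TraceFunction m
incidence v = byTrace (λ S → ⟦ v ∈3 S ⟧) (λ S → ⟦ v ∈2 S ⟧) (λ x → ⟦ v == x ⟧) 0

δ₃ : ∀ {m} → Triple m → TraceFunction m
δ₃ S = byTrace (λ S′ → ⟦ ⌊ S′ ≟₃ S ⌋ ⟧) (λ _ → 0) (λ _ → 0) 0

δ₂ : ∀ {m} → Pair m → TraceFunction m
δ₂ S = byTrace (λ _ → 0) (λ S′ → ⟦ ⌊ S′ ≟₂ S ⌋ ⟧) (λ _ → 0) 0

δ₁ : ∀ {m} → Fin m → TraceFunction m
δ₁ v = byTrace (λ _ → 0) (λ _ → 0) (λ v′ → ⟦ v == v′ ⟧) 0

pairing-δ₃ : ∀ {m} (S : Triple m) X → pairing (δ₃ S) X ≡ at₃ X S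
pairing-δ₃ {m} S X = trans (cong₂ _+_ (cong₂ _+_ (∑-allTriples-pick S (at₃ X)) (∑-0 (allPairs m)))
  (cong (_+ 0) (∑-0 (allFin m)))) (trans (+-identityʳ _) (+-identityʳ _))

pairing-δ₂ : ∀ {m} (S : Pair m) X → pairing (δ₂ S) X ≡ at₂ X S
pairing-δ₂ {m} S X = trans (cong₂ _+_ (cong₂ _+_ (∑-0 (allTriples m)) (∑-allPairs-pick S (at₂ X)))
  (cong (_+ 0) (∑-0 (allFin m)))) (+-identityʳ _)

pairing-δ₁ : ∀ {m} (v : Fin m) X → pairing (δ₁ v) X ≡ at₁ X v
pairing-δ₁ {m} v X = trans (cong₂ _+_ (cong₂ _+_ (∑-0 (allTriples m)) (∑-0 (allPairs m)))
  (cong (_+ 0) (∑-allFin-pick v (at₁ X)))) (+-identityʳ _)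

∑-pairing-incidence : ∀ {m} (X : TraceFunction m) → ∑ (allFin m) (λ v → pairing (incidence v) X) ≡
  (3 * ∑ (allTriples m) (at₃ X) + 2 * ∑ (allPairs m) (at₂ X)) + ∑ (allFin m) (at₁ X)
∑-pairing-incidence {m} X =
  trans (∑-+ (allFin m) _ _) (cong₂ _+_
    (trans (∑-+ (allFin m) _ _) (cong₂ _+_
      (weighted (allTriples m) (at₃ X) (λ v S → ⟦ v ∈3 S ⟧) 3 (λ S →
        trans (∑-cong (allFin m) λ v → sym (*-identityˡ ⟦ v ∈3 S ⟧)) (∑-∈3 (λ _ → 1) S)))
      (weighted (allPairs m) (at₂ X) (λ v S → ⟦ v ∈2 S ⟧) 2 two)))
    (trans (∑-+ (allFin m) _ _) (trans (cong₂ _+_ (weighted (allFin m) (at₁ X) (λ v x → ⟦ v == x ⟧) 1 one) (∑-0 (allFin m)))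
      (trans (+-identityʳ _) (+-identityʳ _)))))
  where
  one : ∀ x → ∑ (allFin m) (λ v → ⟦ v == x ⟧) ≡ 1
  one x = trans (∑-cong (allFin m) λ v → cong ⟦_⟧ (==-sym v x)) (∑-allFin-indicator x)
  two : ∀ S → ∑ (allFin m) (λ v → ⟦ v ∈2 S ⟧) ≡ 2
  two S@(pair a b _) = trans (∑-cong (allFin m) λ v → ⟦∈2⟧ v S) (trans (∑-+ (allFin m) _ _) (cong₂ _+_ (one a) (one b)))
  weighted : {A : Set} (xs : List A) (g : A → ℕ) (f : Fin m → A → ℕ) (c : ℕ) → (∀ x → ∑ (allFin m) (λ v → f v x) ≡ c) →
             ∑ (allFin m) (λ v → ∑ xs (λ x → f v x * g x)) ≡ c * ∑ xs g
  weighted xs g f c eq = trans (∑-swap (allFin m) xs (λ v x → f v x * g x))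
    (trans (∑-cong xs λ x → trans (∑-*ʳ (allFin m) (g x) (λ v → f v x)) (cong (_* g x) (eq x))) (∑-*ˡ xs c g))

pairing-ones : ∀ {m} (X : TraceFunction m) → pairing ones X ≡
  (∑ (allTriples m) (at₃ X) + ∑ (allPairs m) (at₂ X)) + (∑ (allFin m) (at₁ X) + at₀ X)
pairing-ones {m} X = cong₂ _+_
  (cong₂ _+_ (∑-cong (allTriples m) λ _ → +-identityʳ _) (∑-cong (allPairs m) λ _ → +-identityʳ _))
  (cong₂ _+_ (∑-cong (allFin m) λ _ → +-identityʳ _) (+-identityʳ _))

-- Trace-dependent weights, and the color counts of F and of `K_n^3`

module _ {m u : ℕ} where

  V₃ : Triple m → Triple (m + u)
  V₃ = tripleV₃
  V₂ : Pair m → Fin u → Triple (m + u)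
  V₂ = tripleV₂
  V₁ : Fin m → Pair u → Triple (m + u)
  V₁ = tripleV₁
  V₀ : Triple u → Triple (m + u)
  V₀ = tripleV₀

  record DependsOnTrace (h : Triple (m + u) → ℕ) (h′ : TraceFunction m) : Set where
    field
      on₃ : ∀ S → h (V₃ S) ≡ at₃ h′ S
      on₂ : ∀ S t → h (V₂ S t) ≡ at₂ h′ S
      on₁ : ∀ v P → h (V₁ v P) ≡ at₁ h′ v
      on₀ : ∀ T → h (V₀ T) ≡ at₀ h′
  open DependsOnTrace

  constant-dependsOnTrace : DependsOnTrace (λ _ → 1) ones
  constant-dependsOnTrace = record { on₃ = λ _ → refl ; on₂ = λ _ _ → refl ; on₁ = λ _ _ → refl ; on₀ = λ _ → refl }

  incidence-dependsOnTrace : ∀ v → DependsOnTrace (λ e → ⟦ (v ↑ˡ u) ∈3 e ⟧) (incidence v)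
  incidence-dependsOnTrace v = record
    { on₃ = λ { (triple x y z _ _) → cong ⟦_⟧ (cong₂ _∨_ (↑ˡ-== v x) (cong₂ _∨_ (↑ˡ-== v y) (↑ˡ-== v z))) }
    ; on₂ = λ { (pair x y _) t → cong ⟦_⟧ (trans (cong₂ _∨_ (↑ˡ-== v x) (cong₂ _∨_ (↑ˡ-== v y) (↑ˡ-==-↑ʳ v t)))
                (cong ((v == x) ∨_) (Bool.∨-identityʳ (v == y)))) }
    ; on₁ = λ { x (pair y z _) → cong ⟦_⟧ (trans (cong₂ _∨_ (↑ˡ-== v x) (cong₂ _∨_ (↑ˡ-==-↑ʳ v y) (↑ˡ-==-↑ʳ v z)))
                (Bool.∨-identityʳ (v == x))) }
    ; on₀ = λ { (triple x y z _ _) → cong ⟦_⟧ (cong₂ _∨_ (↑ˡ-==-↑ʳ v x) (cong₂ _∨_ (↑ˡ-==-↑ʳ v y) (↑ˡ-==-↑ʳ v z))) }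
    }

  private
    ι<m : ∀ (x : Fin m) → (toℕ (x ↑ˡ u) <ᵇ m) ≡ true
    ι<m x = <ᵇ-true (subst (λ i → suc i ≤ m) (sym (toℕ-↑ˡ x u)) (toℕ<n x))

    m≤↑ʳ : ∀ (x : Fin u) → (toℕ (m ↑ʳ x) <ᵇ m) ≡ false
    m≤↑ʳ x = <ᵇ-false (subst (m ≤_) (sym (toℕ-↑ʳ m x)) (m≤m+n m _))

  trace-V₃ : ∀ S → traceV m (V₃ S) ≡ map (ι u) (elems3 S)
  trace-V₃ (triple x y z _ _) rewrite ι<m x | ι<m y | ι<m z = refl

  trace-V₂ : ∀ S t → traceV m (V₂ S t) ≡ map (ι u) (elems2 S)
  trace-V₂ (pair x y _) t rewrite ι<m x | ι<m y | m≤↑ʳ t = refl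

  trace-V₁ : ∀ v P → traceV m (V₁ v P) ≡ [ ι u v ]
  trace-V₁ v (pair x y _) rewrite ι<m v | m≤↑ʳ x | m≤↑ʳ y = refl

  trace-V₀ : ∀ T → traceV m (V₀ T) ≡ []
  trace-V₀ (triple x y z _ _) rewrite m≤↑ʳ x | m≤↑ʳ y | m≤↑ʳ z = refl

  private
    =L-false : {xs ys : List (Fin (m + u))} → xs ≢ ys → ⟦ xs =L ys ⟧ ≡ 0
    =L-false {xs} {ys} xs≢ys = cong ⟦_⟧ (isYes-false (List-≡-dec Fin._≟_ xs ys) xs≢ys)

    lengths-differ : {xs ys xs′ ys′ : List (Fin (m + u))} → xs ≡ xs′ → ys ≡ ys′ → length xs′ ≢ length ys′ → ⟦ xs =L ys ⟧ ≡ 0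
    lengths-differ refl refl neq = =L-false (neq ∘ cong length)

  δ₃-dependsOnTrace : ∀ S → DependsOnTrace (λ e → ⟦ traceV m e =L map (ι u) (elems3 S) ⟧) (δ₃ S)
  δ₃-dependsOnTrace S@(triple a b c _ _) = record
    { on₃ = λ S′ → cong ⟦_⟧ (trans (cong (_=L map (ι u) (elems3 S)) (trace-V₃ S′)) (isYes-cong _ (S′ ≟₃ S) (same S′) (cong (map (ι u) ∘ elems3))))
    ; on₂ = λ { S′@(pair _ _ _) t → lengths-differ (trace-V₂ S′ t) refl λ () }
    ; on₁ = λ v P → lengths-differ (trace-V₁ v P) refl λ ()
    ; on₀ = λ T → lengths-differ (trace-V₀ T) refl λ ()
    }
    where
    same : ∀ S′ → map (ι u) (elems3 S′) ≡ map (ι u) (elems3 S) → S′ ≡ S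
    same (triple x y z _ _) eq with ∷-injective eq
    ... | x≡ , eq′ with ∷-injective eq′
    ... | y≡ , eq″ = triple-≡ (↑ˡ-injective u x a x≡) (↑ˡ-injective u y b y≡) (↑ˡ-injective u z c (proj₁ (∷-injective eq″)))

  δ₂-dependsOnTrace : ∀ S → DependsOnTrace (λ e → ⟦ traceV m e =L map (ι u) (elems2 S) ⟧) (δ₂ S)
  δ₂-dependsOnTrace S@(pair a b _) = record
    { on₃ = λ { S′@(triple _ _ _ _ _) → lengths-differ (trace-V₃ S′) refl λ () }
    ; on₂ = λ S′ t → cong ⟦_⟧ (trans (cong (_=L map (ι u) (elems2 S)) (trace-V₂ S′ t)) (isYes-cong _ (S′ ≟₂ S) (same S′) (cong (map (ι u) ∘ elems2))))
    ; on₁ = λ v P → lengths-differ (trace-V₁ v P) refl λ ()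
    ; on₀ = λ T → lengths-differ (trace-V₀ T) refl λ ()
    }
    where
    same : ∀ S′ → map (ι u) (elems2 S′) ≡ map (ι u) (elems2 S) → S′ ≡ S
    same (pair x y _) eq with ∷-injective eq
    ... | x≡ , eq′ = pair-≡ (↑ˡ-injective u x a x≡) (↑ˡ-injective u y b (proj₁ (∷-injective eq′)))

  δ₁-dependsOnTrace : ∀ v → DependsOnTrace (λ e → ⟦ traceV m e =L [ ι u v ] ⟧) (δ₁ v)
  δ₁-dependsOnTrace v = record
    { on₃ = λ { S′@(triple _ _ _ _ _) → lengths-differ (trace-V₃ S′) refl λ () }
    ; on₂ = λ { S′@(pair _ _ _) t → lengths-differ (trace-V₂ S′ t) refl λ () }
    ; on₁ = λ v′ P → cong ⟦_⟧ (trans (cong (_=L [ ι u v ]) (trace-V₁ v′ P))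
        (isYes-cong _ (v Fin.≟ v′) (λ eq → sym (↑ˡ-injective u v′ v (proj₁ (∷-injective eq)))) (cong (λ x → [ ι u x ]) ∘ sym)))
    ; on₀ = λ T → lengths-differ (trace-V₀ T) refl λ ()
    }

  module _ {k : ℕ} where

    colorsOf : KColoring (m + u) k → Fin k → TraceFunction m
    colorsOf ψ j = byTrace (λ S → ⟦ ψ (V₃ S) == j ⟧) (λ S → ∑ (allFin u) (λ t → ⟦ ψ (V₂ S t) == j ⟧))
      (λ v → ∑ (allPairs u) (λ P → ⟦ ψ (V₁ v P) == j ⟧)) (∑ (allTriples u) (λ T → ⟦ ψ (V₀ T) == j ⟧))

    ∑-colorsOf : (ψ : KColoring (m + u) k) {h : Triple (m + u) → ℕ} {h′ : TraceFunction m} → DependsOnTrace h h′ → ∀ j →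
                 ∑ (allTriples (m + u)) (λ e → h e * ⟦ ψ e == j ⟧) ≡ pairing h′ (colorsOf ψ j)
    ∑-colorsOf ψ {h} {h′} dep j = trans (∑-allTriples-split {m} {u} _) (cong₂ _+_
      (cong₂ _+_ (∑-cong (allTriples m) λ S → cong (_* _) (on₃ dep S))
        (∑-cong (allPairs m) λ S → trans (∑-cong (allFin u) λ t → cong (_* ⟦ ψ (V₂ S t) == j ⟧) (on₂ dep S t)) (∑-*ˡ (allFin u) (at₂ h′ S) _)))
      (cong₂ _+_ (∑-cong (allFin m) λ v → trans (∑-cong (allPairs u) λ P → cong (_* ⟦ ψ (V₁ v P) == j ⟧) (on₁ dep v P)) (∑-*ˡ (allPairs u) (at₁ h′ v) _))
        (trans (∑-cong (allTriples u) λ T → cong (_* ⟦ ψ (V₀ T) == j ⟧) (on₀ dep T)) (∑-*ˡ (allTriples u) (at₀ h′) _))))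

    module _ (φ : FColoring m u k) where

      -- F has no hyperedges with empty trace; `free j` stands for the number of triples inside U
      -- with color `j`. The value at a 3-set is a count over a one-element list so that it matches
      -- the clause of `Extends` literally.
      colorsOfF : (Fin k → ℕ) → Fin k → TraceFunction m
      colorsOfF free j = byTrace (λ S → count (λ _ → col3 φ S == j) [ S ]) (λ S → count (λ t → col2 φ S t == j) (allFin u))
        (λ v → count (λ s → col1 φ v s == j) (allFin (u C 2))) (free j)

      at₃-colorsOfF : ∀ free j S → at₃ (colorsOfF free j) S ≡ ⟦ col3 φ S == j ⟧
      at₃-colorsOfF free j S = trans (count≡∑ (λ _ → col3 φ S == j) [ S ]) (+-identityʳ _)

      E1 : Fin k → ℕ
      E1 j = ∑ (allFin m) (λ v → count (λ s → col1 φ v s == j) (allFin (u C 2)))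

      E3≡∑ : ∀ free j → E3 φ j ≡ ∑ (allTriples m) (at₃ (colorsOfF free j))
      E3≡∑ free j = trans (count≡∑ (λ S → col3 φ S == j) (allTriples m)) (∑-cong (allTriples m) λ S → sym (at₃-colorsOfF free j S))

      E2≡∑ : ∀ j → E2 φ j ≡ ∑ (allPairs m) (λ S → count (λ t → col2 φ S t == j) (allFin u))
      E2≡∑ j = trans (count≡∑ _ (cartesianProduct (allPairs m) (allFin u)))
        (trans (∑-cartesianProduct (allPairs m) (allFin u) _) (∑-cong (allPairs m) λ S → sym (count≡∑ _ (allFin u))))

      degF≡pairing : ∀ free v j → degF φ v j ≡ pairing (incidence v) (colorsOfF free j)
      degF≡pairing free v j = trans (+-assoc (count _ (allTriples m)) _ _) (trans (cong₂ _+_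
        (trans (count≡∑ _ (allTriples m)) (∑-cong (allTriples m) λ S → trans (⟦∧⟧ (v ∈3 S) _) (cong (⟦ v ∈3 S ⟧ *_) (sym (at₃-colorsOfF free j S)))))
        (cong₂ _+_ (∑-cong (allPairs m) λ S → if-⟦⟧ (v ∈2 S) _) (trans (sym (∑-allFin-pick v (at₁ (colorsOfF free j)))) (sym (+-identityʳ _)))))
        (sym (+-assoc (∑ (allTriples m) (λ S → ⟦ v ∈3 S ⟧ * at₃ (colorsOfF free j) S)) _ _)))
        where
        if-⟦⟧ : ∀ b c → (if b then c else 0) ≡ ⟦ b ⟧ * c
        if-⟦⟧ true c = sym (+-identityʳ c)
        if-⟦⟧ false c = refl

      ∑-degF : ∀ j → ∑ (allFin m) (λ v → degF φ v j) ≡ (3 * E3 φ j + 2 * E2 φ j) + E1 j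
      ∑-degF j = trans (∑-cong (allFin m) λ v → degF≡pairing (λ _ → 0) v j)
        (trans (∑-pairing-incidence (colorsOfF (λ _ → 0) j))
          (cong (_+ E1 j) (cong₂ (λ a b → 3 * a + 2 * b) (sym (E3≡∑ (λ _ → 0) j)) (sym (E2≡∑ j)))))

      pairing-ones-colorsOfF : ∀ free j → pairing ones (colorsOfF free j) ≡ (E3 φ j + E2 φ j) + (E1 j + free j)
      pairing-ones-colorsOfF free j = trans (pairing-ones (colorsOfF free j))
        (cong₂ (λ a b → (a + b) + (E1 j + free j)) (sym (E3≡∑ free j)) (sym (E2≡∑ j)))

-- The two directions

open DependsOnTrace

∑-count-colors : {A : Set} (f : A → Fin k) (xs : List A) → ∑ (allFin k) (λ j → count (λ x → f x == j) xs) ≡ length xs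
∑-count-colors {k} f xs = trans (∑-cong (allFin k) λ j → count≡∑ (λ x → f x == j) xs)
  (trans (∑-swap (allFin k) xs (λ j x → ⟦ f x == j ⟧)) (trans (∑-cong xs λ x → ∑-allFin-indicator (f x)) (sym (length≡∑ xs))))

length-allFin : ∀ n → length (allFin n) ≡ n
length-allFin n = length-tabulate id

-- free j is the number of triples inside U that are to receive color j.
module Initial (φ : FColoring m u k) (free : Fin k → ℕ)
  (total : ∑ (allFin k) free ≡ #triples u) where

  freeColors : List (Fin k)
  freeColors = concatMap (λ j → replicate (free j) j) (allFin k)

  ∑-freeColors : (f : Fin k → ℕ) → ∑ freeColors f ≡ ∑ (allFin k) (λ j → free j * f j)
  ∑-freeColors f = trans (∑-concatMap (allFin k) _ f) (∑-cong (allFin k) λ j → ∑-replicate (free j) j f)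

  -- Copy `t` of a pair is completed by vertex `t` of U, and the copies of a singleton by the pairs
  -- of U in listing order. The triples inside U take the prescribed colors in an arbitrary order.
  coloring : EdgeColoring (m + u) k
  coloring = (map (λ S → V₃ S , col3 φ S) (allTriples m)
      ++ map (λ { (S , t) → V₂ S t , col2 φ S t }) (cartesianProduct (allPairs m) (allFin u)))
    ++ (concatMap (λ v → map (λ { (P , s) → V₁ v P , col1 φ v s }) (zip (allPairs u) (allFin (u C 2)))) (allFin m)
      ++ map (λ { (T , c) → V₀ T , c }) (zip (allTriples u) freeColors))

  ∑-coloring : (F : Triple (m + u) × Fin k → ℕ) → ∑ coloring F ≡
    (∑ (allTriples m) (λ S → F (V₃ S , col3 φ S)) + ∑ (allPairs m) (λ S → ∑ (allFin u) (λ t → F (V₂ S t , col2 φ S t))))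
    + (∑ (allFin m) (λ v → ∑ (zip (allPairs u) (allFin (u C 2))) (λ { (P , s) → F (V₁ v P , col1 φ v s) }))
       + ∑ (zip (allTriples u) freeColors) (λ { (T , c) → F (V₀ T , c) }))
  ∑-coloring F = trans (∑-++ (map _ (allTriples m) ++ map _ (cartesianProduct (allPairs m) (allFin u))) _ F) (cong₂ _+_
    (trans (∑-++ (map _ (allTriples m)) _ F) (cong₂ _+_ (∑-map (allTriples m) _ F)
      (trans (∑-map (cartesianProduct (allPairs m) (allFin u)) _ F) (∑-cartesianProduct (allPairs m) (allFin u) _))))
    (trans (∑-++ (concatMap _ (allFin m)) _ F) (cong₂ _+_
      (trans (∑-concatMap (allFin m) _ F) (∑-cong (allFin m) λ v → ∑-map (zip (allPairs u) (allFin (u C 2))) _ F))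
      (∑-map (zip (allTriples u) freeColors) _ F))))

  private
    length-pairs : length (allPairs u) ≡ length (allFin (u C 2))
    length-pairs = trans (length≡∑ (allPairs u)) (trans (#pairs≡nC2 u) (sym (length-allFin (u C 2))))

    length-triples : length (allTriples u) ≡ length freeColors
    length-triples = trans (length≡∑ (allTriples u)) (trans (sym total) (sym
      (trans (length≡∑ freeColors) (trans (∑-freeColors (λ _ → 1)) (∑-cong (allFin k) λ j → *-identityʳ _)))))

    ∑-zip₁ : {A B : Set} (xs : List A) (ys : List B) → length xs ≡ length ys → (f : A → ℕ) → ∑ (zip xs ys) (f ∘ proj₁) ≡ ∑ xs f
    ∑-zip₁ xs ys len f = trans (sym (∑-map (zip xs ys) proj₁ f)) (cong (λ zs → ∑ zs f) (map-proj₁-zip xs ys len))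

    ∑-zip₂ : {A B : Set} (xs : List A) (ys : List B) → length xs ≡ length ys → (f : B → ℕ) → ∑ (zip xs ys) (f ∘ proj₂) ≡ ∑ ys f
    ∑-zip₂ xs ys len f = trans (sym (∑-map (zip xs ys) proj₂ f)) (cong (λ zs → ∑ zs f) (map-proj₂-zip xs ys len))

  edges↭ : map proj₁ coloring ↭ allTriples (m + u)
  edges↭ = sameMultiplicity⇒↭ _≟₃_ _ _ λ e → sums (λ e′ → ⟦ ⌊ e′ ≟₃ e ⌋ ⟧)
    where
    sums : (f : Triple (m + u) → ℕ) → ∑ (map proj₁ coloring) f ≡ ∑ (allTriples (m + u)) f
    sums f = trans (∑-map coloring proj₁ f) (trans (∑-coloring (f ∘ proj₁)) (trans
      (cong (∑ (allTriples m) (f ∘ V₃) + ∑ (allPairs m) (λ S → ∑ (allFin u) (f ∘ V₂ S)) +_) (cong₂ _+_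
        (∑-cong (allFin m) λ v → ∑-zip₁ (allPairs u) (allFin (u C 2)) length-pairs (f ∘ V₁ v))
        (∑-zip₁ (allTriples u) freeColors length-triples (f ∘ V₀))))
      (sym (∑-allTriples-split {m} {u} f))))

  ∑-coloring-trace : {h : Triple (m + u) → ℕ} {h′ : TraceFunction m} → DependsOnTrace {m} {u} h h′ → ∀ j →
    ∑ coloring (λ { (e , c) → h e * ⟦ c == j ⟧ }) ≡ pairing h′ (colorsOfF {m} {u} φ free j)
  ∑-coloring-trace {h} {h′} dep j = trans (∑-coloring (λ { (e , c) → h e * ⟦ c == j ⟧ })) (cong₂ _+_
    (cong₂ _+_
      (∑-cong (allTriples m) λ S → cong₂ _*_ (on₃ dep S) (sym (at₃-colorsOfF φ free j S)))
      (∑-cong (allPairs m) λ S → trans (∑-cong (allFin u) λ t → cong (_* ⟦ col2 φ S t == j ⟧) (on₂ dep S t))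
        (trans (∑-*ˡ (allFin u) (at₂ h′ S) _) (cong (at₂ h′ S *_) (sym (count≡∑ _ (allFin u)))))))
    (cong₂ _+_
      (∑-cong (allFin m) λ v → trans (∑-cong (zip (allPairs u) (allFin (u C 2))) λ { (P , s) → cong (_* ⟦ col1 φ v s == j ⟧) (on₁ dep v P) })
        (trans (∑-*ˡ (zip (allPairs u) (allFin (u C 2))) (at₁ h′ v) (λ { (P , s) → ⟦ col1 φ v s == j ⟧ }))
          (cong (at₁ h′ v *_) (trans (∑-zip₂ (allPairs u) (allFin (u C 2)) length-pairs (λ s → ⟦ col1 φ v s == j ⟧))
            (sym (count≡∑ _ (allFin (u C 2))))))))
      (trans (∑-cong (zip (allTriples u) freeColors) λ { (T , c) → cong (_* ⟦ c == j ⟧) (on₀ dep T) })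
        (trans (∑-*ˡ (zip (allTriples u) freeColors) (at₀ h′) (λ { (T , c) → ⟦ c == j ⟧ }))
          (cong (at₀ h′ *_) (trans (∑-zip₂ (allTriples u) freeColors length-triples (λ c → ⟦ c == j ⟧))
            (trans (∑-freeColors (λ c → ⟦ c == j ⟧)) (trans
              (∑-cong (allFin k) λ i → trans (*-comm (free i) _) (cong (λ b → ⟦ b ⟧ * free i) (==-sym i j)))
              (∑-allFin-pick j free)))))))))

count-∧ : {A : Set} (p q : A → Bool) (xs : List A) → count (λ x → p x ∧ q x) xs ≡ ∑ xs (λ x → ⟦ p x ⟧ * ⟦ q x ⟧)
count-∧ p q xs = trans (count≡∑ _ xs) (∑-cong xs λ x → ⟦∧⟧ (p x) (q x))

-- The hyperedges of F are in bijection with the triples that meet V, so only the triples inside U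
-- are missing from the total.
∑-#colored : (φ : FColoring m u k) → ∑ (allFin k) (λ j → (E3 φ j + E2 φ j) + E1 {m} {u} φ j) + #triples u ≡ #triples (m + u)
∑-#colored {m} {u} {k} φ = begin
  ∑ (allFin k) (λ j → (E3 φ j + E2 φ j) + E1 {m} {u} φ j) + #triples u
    ≡⟨ cong (_+ #triples u) (trans (∑-+ (allFin k) _ _) (cong₂ _+_ (trans (∑-+ (allFin k) _ _) (cong₂ _+_ all₃ all₂)) all₁)) ⟩
  ((#triples m + ∑ (allPairs m) (λ _ → ∑ (allFin u) (λ _ → 1))) + ∑ (allFin m) (λ _ → #pairs u)) + #triples u
    ≡⟨ +-assoc (#triples m + ∑ (allPairs m) (λ _ → ∑ (allFin u) (λ _ → 1))) _ _ ⟩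
  (#triples m + ∑ (allPairs m) (λ _ → ∑ (allFin u) (λ _ → 1))) + (∑ (allFin m) (λ _ → #pairs u) + #triples u)
    ≡⟨ ∑-allTriples-split {m} {u} (λ _ → 1) ⟨
  #triples (m + u) ∎
  where
  open ≡-Reasoning
  all₃ : ∑ (allFin k) (E3 φ) ≡ #triples m
  all₃ = trans (∑-count-colors (col3 φ) (allTriples m)) (length≡∑ (allTriples m))
  all₂ : ∑ (allFin k) (E2 φ) ≡ ∑ (allPairs m) (λ _ → ∑ (allFin u) (λ _ → 1))
  all₂ = trans (∑-cong (allFin k) (E2≡∑ {m} {u} φ)) (trans (∑-swap (allFin k) (allPairs m) _)
    (∑-cong (allPairs m) λ S → trans (∑-count-colors (col2 φ S) (allFin u)) (length≡∑ (allFin u))))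
  all₁ : ∑ (allFin k) (E1 {m} {u} φ) ≡ ∑ (allFin m) (λ _ → #pairs u)
  all₁ = trans (∑-swap (allFin k) (allFin m) _) (∑-cong (allFin m) λ v →
    trans (∑-count-colors (col1 φ v) (allFin (u C 2))) (trans (length-allFin (u C 2)) (sym (#pairs≡nC2 u))))

Extendable : ℕ → FColoring m u k → Set
Extendable {m} {u} {k} r φ = Σ[ ψ ∈ KColoring (m + u) k ] (IsRFactorization r ψ × Extends φ ψ)

module Forward (r : ℕ) (φ : FColoring m u k) (ψ : KColoring (m + u) k)
  (factorization : IsRFactorization r ψ) (extends : Extends φ ψ) where

  degree≡r : ∀ w j → ∑ (allTriples (m + u)) (λ e → ⟦ w ∈3 e ⟧ * ⟦ ψ e == j ⟧) ≡ r
  degree≡r w j = trans (sym (count-∧ (w ∈3_) (λ e → ψ e == j) (allTriples (m + u)))) (factorization w j)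

  #color : Fin k → ℕ
  #color j = ∑ (allTriples (m + u)) (λ e → ⟦ ψ e == j ⟧)

  3*#color : ∀ j → 3 * #color j ≡ r * (m + u)
  3*#color j = begin
    3 * #color j ≡⟨ ∑-*ˡ (allTriples (m + u)) 3 _ ⟨
    ∑ (allTriples (m + u)) (λ e → 3 * ⟦ ψ e == j ⟧)
      ≡⟨ ∑-cong (allTriples (m + u)) (λ e → trans (cong (_* ⟦ ψ e == j ⟧) (trans (sym (∑-∈3 (λ _ → 1) e)) (∑-cong (allFin (m + u)) λ v → *-identityˡ ⟦ v ∈3 e ⟧)))
           (sym (∑-*ʳ (allFin (m + u)) ⟦ ψ e == j ⟧ (λ v → ⟦ v ∈3 e ⟧)))) ⟩
    ∑ (allTriples (m + u)) (λ e → ∑ (allFin (m + u)) λ v → ⟦ v ∈3 e ⟧ * ⟦ ψ e == j ⟧)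
      ≡⟨ ∑-swap (allTriples (m + u)) (allFin (m + u)) _ ⟩
    ∑ (allFin (m + u)) (λ v → ∑ (allTriples (m + u)) λ e → ⟦ v ∈3 e ⟧ * ⟦ ψ e == j ⟧)
      ≡⟨ ∑-cong (allFin (m + u)) (λ v → degree≡r v j) ⟩
    ∑ (allFin (m + u)) (λ _ → r) ≡⟨ ∑-allFin-const (m + u) r ⟩
    (m + u) * r ≡⟨ *-comm (m + u) r ⟩
    r * (m + u) ∎
    where open ≡-Reasoning

  free : Fin k → ℕ
  free j = at₀ (colorsOf {m} {u} ψ j)

  traceColors : (p : List (Fin (m + u)) → Bool) {h′ : TraceFunction m} →
    DependsOnTrace {m} {u} (λ e → ⟦ p (traceV m e) ⟧) h′ → ∀ j →
    count (λ e → p (traceV m e) ∧ (ψ e == j)) (allTriples (m + u)) ≡ pairing h′ (colorsOf {m} {u} ψ j)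
  traceColors p dep j = trans (count-∧ (λ e → p (traceV m e)) (λ e → ψ e == j) (allTriples (m + u))) (∑-colorsOf ψ dep j)

  -- Pairing with a delta function reads off the colors at one nonempty trace, where `Extends` gives
  -- equality; at the empty trace equality holds by the choice of `free`. Every trace-dependent
  -- weight therefore has the same total in `ψ` and in F.
  pairing-colors : ∀ j h → pairing h (colorsOf {m} {u} ψ j) ≡ pairing h (colorsOfF {m} {u} φ free j)
  pairing-colors j h = pairing-congʳ h {X} {colorsOfF {m} {u} φ free j}
    (λ S → trans (sym (trans (traceColors (_=L map (ι u) (elems3 S)) (δ₃-dependsOnTrace S) j) (pairing-δ₃ S X))) (proj₁ extends S j))
    (λ S → trans (sym (trans (traceColors (_=L map (ι u) (elems2 S)) (δ₂-dependsOnTrace S) j) (pairing-δ₂ S X))) (proj₁ (proj₂ extends) S j))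
    (λ v → trans (sym (trans (traceColors (_=L [ ι u v ]) (δ₁-dependsOnTrace v) j) (pairing-δ₁ v X))) (proj₂ (proj₂ extends) v j))
    refl
    where
    X : TraceFunction m
    X = colorsOf {m} {u} ψ j

  degF≡r : ∀ v j → degF φ v j ≡ r
  degF≡r v j = trans (degF≡pairing {m} {u} φ free v j) (trans (sym (pairing-colors j (incidence v)))
    (trans (sym (∑-colorsOf ψ (incidence-dependsOnTrace {m} {u} v) j)) (degree≡r (v ↑ˡ u) j)))

  #color≡ : ∀ j → #color j ≡ (E3 φ j + E2 φ j) + (E1 {m} {u} φ j + free j)
  #color≡ j = trans (∑-cong (allTriples (m + u)) λ e → sym (*-identityˡ ⟦ ψ e == j ⟧))
    (trans (∑-colorsOf ψ (constant-dependsOnTrace {m} {u}) j) (trans (pairing-colors j ones) (pairing-ones-colorsOfF {m} {u} φ free j)))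

  -- Condition (v) cleared of the fraction and of subtraction. The degree sum over V is
  -- `3 * E3 + 2 * E2 + E1`, which is `E2 + 2 * E3` plus the number of hyperedges of F with this
  -- color.
  sizeBound : ∀ j → r * m * 3 ≤ 3 * (E2 φ j + 2 * E3 φ j) + r * (m + u)
  sizeBound j = begin
    r * m * 3 ≡⟨ cong (_* 3) (trans (*-comm r m) (sym (∑-allFin-const m r))) ⟩
    ∑ (allFin m) (λ _ → r) * 3 ≡⟨ cong (_* 3) (trans (∑-cong (allFin m) λ v → sym (degF≡r v j)) (∑-degF {m} {u} φ j)) ⟩
    -- The only loss in the chain: adding the triples inside U, whose number is not negative.
    ((3 * E3 φ j + 2 * E2 φ j) + E1 {m} {u} φ j) * 3 ≤⟨ m≤m+n _ (3 * free j) ⟩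
    ((3 * E3 φ j + 2 * E2 φ j) + E1 {m} {u} φ j) * 3 + 3 * free j ≡⟨ lemma (E3 φ j) (E2 φ j) (E1 {m} {u} φ j) (free j) ⟩
    3 * (E2 φ j + 2 * E3 φ j) + 3 * ((E3 φ j + E2 φ j) + (E1 {m} {u} φ j + free j))
      ≡⟨ cong (λ c → 3 * (E2 φ j + 2 * E3 φ j) + 3 * c) (#color≡ j) ⟨
    3 * (E2 φ j + 2 * E3 φ j) + 3 * #color j ≡⟨ cong (3 * (E2 φ j + 2 * E3 φ j) +_) (3*#color j) ⟩
    3 * (E2 φ j + 2 * E3 φ j) + r * (m + u) ∎
    where
    open ≤-Reasoning
    lemma : ∀ a b c d → ((3 * a + 2 * b) + c) * 3 + 3 * d ≡ 3 * (b + 2 * a) + 3 * ((a + b) + (c + d))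
    lemma = solve-∀

-- Counts the hyperedges through one vertex, color by color and all at once.
k*degree : ∀ {N} (r : ℕ) (ψ : KColoring (suc N) k) → IsRFactorization r ψ → k * r ≡ N C 2
k*degree {k} {N} r ψ factorization = begin
  k * r ≡⟨ ∑-allFin-const k r ⟨
  ∑ (allFin k) (λ _ → r) ≡⟨ (∑-cong (allFin k) λ j → trans (sym (factorization zero j)) (count-∧ (zero ∈3_) (λ e → ψ e == j) (allTriples (suc N)))) ⟩
  ∑ (allFin k) (λ j → ∑ (allTriples (suc N)) λ e → ⟦ zero ∈3 e ⟧ * ⟦ ψ e == j ⟧)
    ≡⟨ ∑-swap (allFin k) (allTriples (suc N)) _ ⟩
  ∑ (allTriples (suc N)) (λ e → ∑ (allFin k) λ j → ⟦ zero ∈3 e ⟧ * ⟦ ψ e == j ⟧)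
    ≡⟨ (∑-cong (allTriples (suc N)) λ e → trans (∑-*ˡ (allFin k) ⟦ zero ∈3 e ⟧ _) (trans (cong (⟦ zero ∈3 e ⟧ *_) (∑-allFin-indicator (ψ e))) (*-identityʳ _))) ⟩
  ∑ (allTriples (suc N)) (λ e → ⟦ zero ∈3 e ⟧) ≡⟨ ∑-triples∋0 N ⟩
  #pairs N ≡⟨ #pairs≡nC2 N ⟩
  N C 2 ∎
  where open ≡-Reasoning

-- `q` is the common size `rn/3` of the color classes to be constructed, and `default` makes color
-- lookup in a list total.
module Backward (r q : ℕ) (φ : FColoring m u k) (default : Fin k)
  (3q≡rn : 3 * q ≡ r * (m + u))
  (kq≡#triples : k * q ≡ #triples (m + u))
  (degF≡r : (v : Fin m) (j : Fin k) → degF φ v j ≡ r)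
  (sizeBound : (j : Fin k) → r * m * 3 ≤ 3 * (E2 φ j + 2 * E3 φ j) + r * (m + u)) where

  private
    used : Fin k → ℕ
    used j = (E3 φ j + E2 φ j) + E1 {m} {u} φ j

    -- The identity behind the necessity of (v), read in the other direction: the bound leaves room
    -- for `q ∸ used j` triples inside U, and this truncated subtraction is a true one.
    used≤q : ∀ j → used j ≤ q
    used≤q j = *-cancelˡ-≤ 3 (+-cancelˡ-≤ (3 * (E2 φ j + 2 * E3 φ j)) _ _ (begin
      3 * (E2 φ j + 2 * E3 φ j) + 3 * used j ≡⟨ lemma (E3 φ j) (E2 φ j) (E1 {m} {u} φ j) ⟩
      ((3 * E3 φ j + 2 * E2 φ j) + E1 {m} {u} φ j) * 3 ≡⟨ cong (_* 3) (∑-degF {m} {u} φ j) ⟨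
      ∑ (allFin m) (λ v → degF φ v j) * 3 ≡⟨ cong (_* 3) (trans (∑-cong (allFin m) λ v → degF≡r v j) (trans (∑-allFin-const m r) (*-comm m r))) ⟩
      r * m * 3 ≤⟨ sizeBound j ⟩
      3 * (E2 φ j + 2 * E3 φ j) + r * (m + u) ≡⟨ cong (3 * (E2 φ j + 2 * E3 φ j) +_) 3q≡rn ⟨
      3 * (E2 φ j + 2 * E3 φ j) + 3 * q ∎))
      where
      open ≤-Reasoning
      lemma : ∀ a b c → 3 * (b + 2 * a) + 3 * ((a + b) + c) ≡ ((3 * a + 2 * b) + c) * 3
      lemma = solve-∀

    free : Fin k → ℕ
    free j = q ∸ used j

    -- Both `k * q` and the hyperedges of F together with the triples inside U count all triples;
    -- cancelling F leaves the claim.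
    free-total : ∑ (allFin k) free ≡ #triples u
    free-total = +-cancelˡ-≡ (∑ (allFin k) used) _ _ (begin
      ∑ (allFin k) used + ∑ (allFin k) free ≡⟨ ∑-+ (allFin k) used free ⟨
      ∑ (allFin k) (λ j → used j + free j) ≡⟨ ∑-cong (allFin k) (λ j → m+[n∸m]≡n (used≤q j)) ⟩
      ∑ (allFin k) (λ _ → q) ≡⟨ ∑-allFin-const k q ⟩
      k * q ≡⟨ kq≡#triples ⟩
      #triples (m + u) ≡⟨ ∑-#colored {m} {u} φ ⟨
      ∑ (allFin k) used + #triples u ∎)
      where open ≡-Reasoning

    open Initial φ free free-total
    open Disentangle (m + u) k r m coloring
    open SplitUpTo

    initial : SplitUpTo m coloring
    initial = record
      { edges = edges↭
      ; degrees = λ v j v<m → subst (λ w → degree coloring w j ≡ r) (toℕ-injective (trans (toℕ-↑ˡ (fromℕ< v<m) u) (toℕ-fromℕ< v<m)))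
          (trans (∑-coloring-trace (incidence-dependsOnTrace (fromℕ< v<m)) j)
            (trans (sym (degF≡pairing {m} {u} φ free (fromℕ< v<m) j)) (degF≡r (fromℕ< v<m) j)))
      ; sizes = λ j → trans (cong (3 *_) (size j)) 3q≡rn
      ; traces = λ F _ → refl
      }
      where
      size : ∀ j → ∑ coloring (λ { (_ , c) → ⟦ c == j ⟧ }) ≡ q
      size j = trans (∑-cong coloring λ { (_ , c) → sym (*-identityˡ ⟦ c == j ⟧) })
        (trans (∑-coloring-trace (constant-dependsOnTrace {m} {u}) j) (trans (pairing-ones-colorsOfF {m} {u} φ free j)
          (trans (sym (+-assoc (E3 φ j + E2 φ j) (E1 {m} {u} φ j) (free j))) (m+[n∸m]≡n (used≤q j)))))

    module _ (L : EdgeColoring (m + u) k) (split : SplitUpTo (m + u) L) where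

      ψ : KColoring (m + u) k
      ψ = lookupColor _≟₃_ default L

      ∑-ψ : (F : Triple (m + u) × Fin k → ℕ) → ∑ (allTriples (m + u)) (λ e → F (e , ψ e)) ≡ ∑ L F
      ∑-ψ F = trans (∑-↭ (λ e → F (e , ψ e)) (↭-sym (edges split))) (∑-lookupColor _≟₃_ default L
        (λ e → ≤-reflexive (trans (∑-↭ _ (edges split)) (multiplicity-allTriples e))) F)

      traceColors : (p : List (Fin (m + u)) → Bool) {h′ : TraceFunction m} → DependsOnTrace {m} {u} (λ e → ⟦ p (traceV m e) ⟧) h′ → ∀ j →
        count (λ e → p (traceV m e) ∧ (ψ e == j)) (allTriples (m + u)) ≡ pairing h′ (colorsOfF {m} {u} φ free j)
      traceColors p dep j = trans (count-∧ (λ e → p (traceV m e)) (λ e → ψ e == j) (allTriples (m + u)))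
        (trans (∑-ψ (λ { (e , c) → ⟦ p (traceV m e) ⟧ * ⟦ c == j ⟧ }))
          (trans (traces split _ (λ e e′ c eq → cong (λ s → ⟦ p s ⟧ * ⟦ c == j ⟧) eq)) (∑-coloring-trace dep j)))

      fromSplit : Extendable r φ
      fromSplit = ψ
        , (λ w j → trans (count-∧ (w ∈3_) (λ e → ψ e == j) (allTriples (m + u)))
            (trans (∑-ψ (λ { (e , c) → ⟦ w ∈3 e ⟧ * ⟦ c == j ⟧ })) (degrees split w j (toℕ<n w))))
        , (λ S j → trans (traceColors (_=L map (ι u) (elems3 S)) (δ₃-dependsOnTrace S) j) (pairing-δ₃ S (colorsOfF {m} {u} φ free j)))
        , (λ S j → trans (traceColors (_=L map (ι u) (elems2 S)) (δ₂-dependsOnTrace S) j) (pairing-δ₂ S (colorsOfF {m} {u} φ free j)))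
        , (λ v j → trans (traceColors (_=L [ ι u v ]) (δ₁-dependsOnTrace v) j) (pairing-δ₁ v (colorsOfF {m} {u} φ free j)))

  extension : Extendable r φ
  extension = fromAll (splitAll u m refl ≤-refl coloring initial)
    where
    fromAll : Σ[ L ∈ EdgeColoring (m + u) k ] SplitUpTo (m + u) L → Extendable r φ
    fromAll (L , split) = fromSplit L split

-- Stated with `m + u ≡ n` so that matching on `refl` removes all transport along `m + (n ∸ m) ≡ n`.
-- Writing `m` as a successor lets `n ∸ 1` compute and provides the vertex `zero` at which `k * r`
-- is counted.
extendable⇔ : (m u n r k : ℕ) → 1 ≤ m → m + u ≡ n → .{{_ : NonZero r}} → 1 ≤ k → (φ : FColoring m u k) →
  Extendable r φ
  ⇔ ((3 ∣ r * n)
    × (r ∣ (n ∸ 1) C 2)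
    × (k ≡ ((n ∸ 1) C 2) / r)
    × ((v : Fin m) (j : Fin k) → degF φ v j ≡ r)
    × ((j : Fin k) → r * m * 3 ≤ 3 * (E2 φ j + 2 * E3 φ j) + r * n))
extendable⇔ (suc m) u _ r k _ refl 1≤k φ = mk⇔ to from
  where
  N : ℕ
  N = suc (m + u)
  j₀ : Fin k
  j₀ = fromℕ< 1≤k

  to : Extendable r φ → _
  to (ψ , factorization , extends) =
      -- The quotient is the number of hyperedges of some color; `1≤k` supplies that color.
      divides (F.#color j₀) (trans (sym (F.3*#color j₀)) (*-comm 3 (F.#color j₀)))
    , divides k (sym kr≡)
    , trans (sym (m*n/n≡m k r)) (cong (_/ r) kr≡)
    , F.degF≡r
    , F.sizeBound
    where
    module F = Forward {suc m} {u} {k} r φ ψ factorization extends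
    kr≡ : k * r ≡ (m + u) C 2
    kr≡ = k*degree r ψ factorization

  from : _ → Extendable r φ
  from (divides q rn≡q3 , r∣ , k≡ , degF≡r , sizeBound) =
    Backward.extension r q φ j₀ (trans (*-comm 3 q) (sym rn≡q3)) (*-cancelˡ-≡ (k * q) (#triples N) 3 3kq≡) degF≡r sizeBound
    where
    kr≡ : k * r ≡ #pairs (m + u)
    kr≡ = trans (cong (_* r) k≡) (trans (m/n*n≡m r∣) (sym (#pairs≡nC2 (m + u))))
    -- The color classes exhaust `K_n^3`: three times their total size is `k` times `r * N`, that is
    -- `N` times the number of pairs on `m + u` vertices, which is three times the number of
    -- triples.
    3kq≡ : 3 * (k * q) ≡ 3 * #triples N
    3kq≡ = begin
      3 * (k * q) ≡⟨ lemma k q ⟩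
      k * (q * 3) ≡⟨ cong (k *_) rn≡q3 ⟨
      k * (r * N) ≡⟨ *-assoc k r N ⟨
      k * r * N ≡⟨ cong (_* N) kr≡ ⟩
      #pairs (m + u) * N ≡⟨ *-comm (#pairs (m + u)) N ⟩
      N * #pairs (m + u) ≡⟨ 3*#triples (m + u) ⟨
      3 * #triples N ∎
      where
      open ≡-Reasoning
      lemma : ∀ a b → 3 * (a * b) ≡ a * (b * 3)
      lemma = solve-∀

theorem4p1 : (m n r k : ℕ) → 1 ≤ m → m ≤ n → .{{_ : NonZero r}} → 1 ≤ k →
    (φ : FColoring m (n ∸ m) k) →
    (Σ[ ψ ∈ KColoring (m + (n ∸ m)) k ] (IsRFactorization r ψ × Extends φ ψ))
    ⇔ ((3 ∣ r * n)
    × (r ∣ (n ∸ 1) C 2)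
    × (k ≡ ((n ∸ 1) C 2) / r)
    × ((v : Fin m) (j : Fin k) → degF φ v j ≡ r)
    × ((j : Fin k) → r * m * 3 ≤ 3 * (E2 φ j + 2 * E3 φ j) + r * n))
theorem4p1 m n r k 1≤m m≤n 1≤k φ = extendable⇔ m (n ∸ m) n r k 1≤m (m+[n∸m]≡n m≤n) 1≤k φ
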